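{- Let $d\ge 5$ and let $h,g$ be distinct $d$-uniform hypergraphs on the same vertex set with $\mathrm{Proj}(h)=\mathrm{Proj}(g)$ and $e(h)\ge e(g)$. Then $d-1-\frac{1}{m(h)}\ge\frac{2d-4}{2d-1}$.
   Context: $\mathrm{Proj}(H)$ is the graph on the vertex set of $H$ with $\{i,j\}$ an edge iff some hyperedge contains $\{i,j\}$. $e(\cdot)$ and $v(\cdot)$ are numbers of hyperedges and vertices; $m(H)=\max_{K\subseteq H} e(K)/v(K)$ over subhypergraphs $K$ of $H$. -}

module Defs where

open import Data.Nat as ℕ using (ℕ; zero; suc; NonZero)
open import Data.Bool using (Bool; true; false)
open import Data.List using (List; []; _∷_; _++_; map; length; filterᵇ)
open import Data.Vec using (_∷_; [])
open import Data.Fin using (Fin)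
open import Data.Fin.Subset using (Subset; _∈_; _⊆_; ∣_∣)
open import Data.Integer using (+_)
open import Data.Rational using (ℚ; _/_; _≤_)
open import Data.Product using (Σ; ∃; _×_)
open import Relation.Binary.PropositionalEquality using (_≡_; _≢_)
open import Function.Bundles using (_⇔_)
open import Relation.Nullary using (¬_)

allSubsets : (n : ℕ) → List (Subset n)
allSubsets zero = [] ∷ []
allSubsets (suc n) = map (true ∷_) (allSubsets n) ++ map (false ∷_) (allSubsets n)

-- A hypergraph on vertex set Fin n: the characteristic function of its
-- set of hyperedges (each hyperedge a subset of Fin n).
Hypergraph : ℕ → Set
Hypergraph n = Subset n → Bool

Uniform : ∀ {n} → ℕ → Hypergraph n → Set
Uniform d h = ∀ e → h e ≡ true → ∣ e ∣ ≡ d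

numEdges : ∀ {n} → Hypergraph n → ℕ
numEdges {n} h = length (filterᵇ h (allSubsets n))

ProjEdge : ∀ {n} → Hypergraph n → Fin n → Fin n → Set
ProjEdge h i j = i ≢ j × ∃ λ e → h e ≡ true × i ∈ e × j ∈ e

SameProj : ∀ {n} → Hypergraph n → Hypergraph n → Set
SameProj h g = ∀ i j → ProjEdge h i j ⇔ ProjEdge g i j

Distinct : ∀ {n} → Hypergraph n → Hypergraph n → Set
Distinct h g = ¬ (∀ e → h e ≡ g e)

record SubHypergraph {n} (h : Hypergraph n) : Set where
  field
    verts : Subset n
    edges : Hypergraph n
    edges⊆ : ∀ e → edges e ≡ true → h e ≡ true
    edgesInVerts : ∀ e → edges e ≡ true → e ⊆ verts

open SubHypergraph public

vK : ∀ {n} {h : Hypergraph n} → SubHypergraph h → ℕ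
vK K = ∣ verts K ∣

eK : ∀ {n} {h : Hypergraph n} → SubHypergraph h → ℕ
eK K = numEdges (edges K)

density : ∀ {n} {h : Hypergraph n} (K : SubHypergraph h) → .{{NonZero (vK K)}} → ℚ
density K = (+ eK K) / vK K

IsMaxDensity : ∀ {n} → Hypergraph n → ℚ → Set
IsMaxDensity h q =
  (Σ (SubHypergraph h) λ K → Σ (NonZero (vK K)) λ nz → density K {{nz}} ≡ q)
  × (∀ (K : SubHypergraph h) (nz : NonZero (vK K)) → density K {{nz}} ≤ q)

{-# OPTIONS --safe #-}

-- Write M = 2d − 1 and N = 2d² − 5d + 5; the claim is that some K ⊆ h has M v(K) ≤ N e(K).
-- Let F be the symmetric difference of h and g, V the union of its edges, and call a pair of vertices
-- private if exactly one edge of F contains it.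
--
-- (1) 2M|V| ≤ N|F| + 6·#private pairs. Every vertex spreads a demand of at least 1 over its
-- edges: 1, 1/2 or 1/3 to each edge according to whether its degree is 1, 2 or more. An edge with few private
-- pairs has almost only vertices of degree at least 3 and so a small demand; an edge with many low-degree
-- vertices has many private pairs.
--
-- (2) A private pair lies in exactly one of Proj(h \ g) and Proj(g \ h), so it is covered by an edge of h ∩ g.
-- Take K to be the edges of h that meet V in at least 2 vertices. An edge of h ∩ g with s ≥ 2 vertices in V brings
-- d − s new vertices and covers at most s(s − 1)/2 private pairs, and 2M(d − s) + 3s(s − 1) ≤ 2N because d ≥ 5.
-- Summing, and using |F| ≤ 2|h \ g|, gives 2M v(K) ≤ 2N e(K).

module Submission where

open import Defs
open import Data.Nat as ℕ using (ℕ; zero; suc; _+_; _*_; _∸_; z≤n; s≤s)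
open import Data.Nat.Coprimality using (Coprime)
open import Data.Nat.ListAction using (sum)
open import Data.Nat.ListAction.Properties using (sum-++)
open import Data.Nat.Properties hiding (_≟_)
open import Data.Nat.Tactic.RingSolver using (solve-∀)
open import Data.Bool using (Bool; true; false; not; _∧_; _xor_)
open import Data.Bool.Properties using (∧-conicalˡ; ∧-conicalʳ) renaming (_≟_ to _≟ᵇ_)
open import Data.Empty using (⊥-elim)
open import Data.Fin using (Fin; zero; suc)
open import Data.Fin.Properties using (any?) renaming (_≟_ to _≟ᶠ_)
open import Data.Fin.Subset using (Subset; ∣_∣; _∈_)
open import Data.Fin.Subset.Properties using (p⊂q⇒∣p∣<∣q∣; p⊆q⇒∣p∣≤∣q∣; ⊆-antisym; _∈?_)
open import Data.List using (List; []; _∷_; _++_; map; length; filterᵇ; allFin; tabulate)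
open import Data.List.Properties using (map-++; map-∘; map-tabulate)
open import Data.Product using (Σ; ∃; _×_; _,_; proj₁; proj₂)
open import Data.Sum using (_⊎_; inj₁; inj₂)
open import Data.Vec using ([]; _∷_; lookup)
import Data.Vec as Vec
import Data.Vec.Properties as Vec
import Data.Integer as ℤ
import Data.Integer.Properties as ℤ
import Data.Rational as ℚ
import Data.Rational.Properties as ℚ
import Data.Rational.Unnormalised as ℚᵘ
import Data.Rational.Unnormalised.Properties as ℚᵘ
open import Function using (_∘_)
open import Function.Bundles using (Equivalence)
open import Relation.Binary.Definitions using (DecidableEquality)
open import Relation.Binary.PropositionalEquality
open import Relation.Nullary using (¬_; Dec; yes; no; does)
open import Relation.Nullary.Decidable using (dec-true; dec-false; _×-dec_; ¬?; decidable-stable)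

⟦_⟧ : Bool → ℕ
⟦ true ⟧ = 1
⟦ false ⟧ = 0

⟦⟧≤1 : ∀ b → ⟦ b ⟧ ℕ.≤ 1
⟦⟧≤1 true = ≤-refl
⟦⟧≤1 false = z≤n

-- Finite sums

∑ : {A : Set} → List A → (A → ℕ) → ℕ
∑ L f = sum (map f L)

∑-syntax : {A : Set} → List A → (A → ℕ) → ℕ
∑-syntax = ∑

syntax ∑-syntax L (λ x → t) = ∑[ x ∈ L ] t

module _ {A : Set} where

  ∑-mono : (L : List A) {f g : A → ℕ} → (∀ x → f x ℕ.≤ g x) → ∑ L f ℕ.≤ ∑ L g
  ∑-mono [] p = z≤n
  ∑-mono (x ∷ L) p = +-mono-≤ (p x) (∑-mono L p)

  ∑-cong : (L : List A) {f g : A → ℕ} → (∀ x → f x ≡ g x) → ∑ L f ≡ ∑ L g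
  ∑-cong [] p = refl
  ∑-cong (x ∷ L) p = cong₂ _+_ (p x) (∑-cong L p)

  ∑-+ : (L : List A) (f g : A → ℕ) → ∑[ x ∈ L ] (f x + g x) ≡ ∑ L f + ∑ L g
  ∑-+ [] f g = refl
  ∑-+ (x ∷ L) f g rewrite ∑-+ L f g = interchange (f x) (g x) (∑ L f) (∑ L g)
    where
    interchange : ∀ a b c d → a + b + (c + d) ≡ a + c + (b + d)
    interchange = solve-∀

  ∑-*ˡ : (L : List A) (c : ℕ) (f : A → ℕ) → ∑[ x ∈ L ] (c * f x) ≡ c * ∑ L f
  ∑-*ˡ [] c f = sym (*-zeroʳ c)
  ∑-*ˡ (x ∷ L) c f rewrite ∑-*ˡ L c f = sym (*-distribˡ-+ c (f x) (∑ L f))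

  ∑-*ʳ : (L : List A) (c : ℕ) (f : A → ℕ) → ∑[ x ∈ L ] (f x * c) ≡ ∑ L f * c
  ∑-*ʳ L c f = trans (∑-cong L (λ x → *-comm (f x) c)) (trans (∑-*ˡ L c f) (*-comm c (∑ L f)))

  ∑-0 : (L : List A) → ∑[ x ∈ L ] 0 ≡ 0
  ∑-0 [] = refl
  ∑-0 (x ∷ L) = ∑-0 L

  ∑-++ : (L L′ : List A) (f : A → ℕ) → ∑ (L ++ L′) f ≡ ∑ L f + ∑ L′ f
  ∑-++ L L′ f = trans (cong sum (map-++ f L L′)) (sum-++ (map f L) (map f L′))

  -- The source of every witness below: edges and vertices are obtained from counts known to be
  -- positive.
  ∑-pos : (L : List A) (f : A → ℕ) → 1 ℕ.≤ ∑ L f → ∃ λ x → 1 ℕ.≤ f x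
  ∑-pos (x ∷ L) f p with f x in eq
  ... | suc k = x , ≤-trans (s≤s z≤n) (≤-reflexive (sym eq))
  ... | zero = ∑-pos L f p

∑-map : {A B : Set} (L : List A) (g : A → B) (f : B → ℕ) → ∑ (map g L) f ≡ ∑ L (f ∘ g)
∑-map L g f = cong sum (sym (map-∘ L))

∑-swap : {A B : Set} (L : List A) (L′ : List B) (f : A → B → ℕ) →
  ∑[ x ∈ L ] ∑ L′ (f x) ≡ ∑[ y ∈ L′ ] ∑[ x ∈ L ] f x y
∑-swap [] L′ f = sym (∑-0 L′)
∑-swap (x ∷ L) L′ f =
  trans (cong (∑ L′ (f x) +_) (∑-swap L L′ f)) (sym (∑-+ L′ (f x) (λ y → ∑[ z ∈ L ] f z y)))

-- Sums over a type listed without repetition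

record Enumeration (A : Set) : Set where
  field
    list : List A
    _≟_ : DecidableEquality A
    -- Says that `a` occurs exactly once in `list`, phrased as a delta-function identity so that
    -- single terms can be split off a sum directly.
    once : ∀ (f : A → ℕ) a → ∑[ x ∈ list ] (⟦ does (x ≟ a) ⟧ * f x) ≡ f a

  -- Setting one value to zero, instead of deleting an element, keeps the index list fixed and
  -- avoids subtraction.
  _except_ : (A → ℕ) → A → A → ℕ
  (f except a) x = ⟦ not (does (x ≟ a)) ⟧ * f x

  except-other : ∀ f {a x} → x ≢ a → (f except a) x ≡ f x
  except-other f {a} {x} x≢a rewrite dec-false (x ≟ a) x≢a = *-identityˡ (f x)

  except-pos : ∀ f a x → 1 ℕ.≤ (f except a) x → x ≢ a × 1 ℕ.≤ f x
  except-pos f a x p with x ≟ a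
  ... | no x≢a = x≢a , ≤-trans p (≤-reflexive (*-identityˡ (f x)))

  split : ∀ f a → ∑ list f ≡ f a + ∑ list (f except a)
  split f a = begin
    ∑ list f
      ≡⟨ ∑-cong list pointwise ⟩
    ∑[ x ∈ list ] (⟦ does (x ≟ a) ⟧ * f x + (f except a) x)
      ≡⟨ ∑-+ list (λ x → ⟦ does (x ≟ a) ⟧ * f x) (f except a) ⟩
    ∑[ x ∈ list ] (⟦ does (x ≟ a) ⟧ * f x) + ∑ list (f except a)
      ≡⟨ cong (_+ ∑ list (f except a)) (once f a) ⟩
    f a + ∑ list (f except a) ∎
    where
    open ≡-Reasoning
    pointwise : ∀ x → f x ≡ ⟦ does (x ≟ a) ⟧ * f x + (f except a) x
    pointwise x with does (x ≟ a)
    ... | true = sym (trans (+-identityʳ (1 * f x)) (*-identityˡ (f x)))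
    ... | false = sym (*-identityˡ (f x))

  term≤∑ : ∀ f a → f a ℕ.≤ ∑ list f
  term≤∑ f a = ≤-trans (m≤m+n (f a) _) (≤-reflexive (sym (split f a)))

  terms₂≤∑ : ∀ f {a b} → b ≢ a → f a + f b ℕ.≤ ∑ list f
  terms₂≤∑ f {a} {b} b≢a = begin
    f a + f b                 ≡⟨ cong (f a +_) (except-other f b≢a) ⟨
    f a + (f except a) b      ≤⟨ +-monoʳ-≤ (f a) (term≤∑ (f except a) b) ⟩
    f a + ∑ list (f except a) ≡⟨ split f a ⟨
    ∑ list f                  ∎
    where open ≤-Reasoning

  terms₃≤∑ : ∀ f {a b c} → b ≢ a → c ≢ a → c ≢ b → f a + (f b + f c) ℕ.≤ ∑ list f
  terms₃≤∑ f {a} {b} {c} b≢a c≢a c≢b = begin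
    f a + (f b + f c)
      ≡⟨ cong (f a +_) (cong₂ _+_ (except-other f b≢a) (except-other f c≢a)) ⟨
    f a + ((f except a) b + (f except a) c)
      ≤⟨ +-monoʳ-≤ (f a) (terms₂≤∑ (f except a) c≢b) ⟩
    f a + ∑ list (f except a)
      ≡⟨ split f a ⟨
    ∑ list f ∎
    where open ≤-Reasoning

  split₂ : ∀ f {a b} → b ≢ a → ∑ list f ≡ f a + (f b + ∑ list ((f except a) except b))
  split₂ f {a} {b} b≢a = trans (split f a) (cong (f a +_)
    (trans (split (f except a) b) (cong (_+ ∑ list ((f except a) except b)) (except-other f b≢a))))

  except-mono : ∀ f g a → (∀ x → f x ℕ.≤ g x) → ∀ x → (f except a) x ℕ.≤ (g except a) x
  except-mono f g a p x = *-monoʳ-≤ ⟦ not (does (x ≟ a)) ⟧ (p x)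

suc-≟ : ∀ {n} (x a : Fin n) → does (suc x ≟ᶠ suc a) ≡ does (x ≟ᶠ a)
suc-≟ x a with x ≟ᶠ a
... | yes refl = refl
... | no _ = refl

finE : ∀ n → Enumeration (Fin n)
finE n = record { list = allFin n ; _≟_ = _≟ᶠ_ ; once = go n }
  where
  shift : ∀ n (f : Fin (suc n) → ℕ) → ∑ (allFin (suc n)) f ≡ f zero + ∑ (allFin n) (f ∘ suc)
  shift n f = cong (f zero +_)
    (trans (cong (λ L → ∑ L f) (sym (map-tabulate (λ x → x) suc))) (∑-map (allFin n) suc f))
  go : ∀ n (f : Fin n → ℕ) a → ∑[ x ∈ allFin n ] (⟦ does (x ≟ᶠ a) ⟧ * f x) ≡ f a
  go (suc n) f zero = trans (shift n (λ x → ⟦ does (x ≟ᶠ zero) ⟧ * f x))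
    (trans (cong₂ _+_ (*-identityˡ (f zero)) (∑-0 (allFin n))) (+-identityʳ (f zero)))
  go (suc n) f (suc a) = trans (shift n (λ x → ⟦ does (x ≟ᶠ suc a) ⟧ * f x))
    (trans (∑-cong (allFin n) (λ x → cong (λ b → ⟦ b ⟧ * f (suc x)) (suc-≟ x a))) (go n (f ∘ suc) a))

_≟ˢ_ : ∀ {n} → DecidableEquality (Subset n)
_≟ˢ_ = Vec.≡-dec _≟ᵇ_

subsetE : ∀ n → Enumeration (Subset n)
subsetE n = record { list = allSubsets n ; _≟_ = _≟ˢ_ ; once = go n }
  where
  branches : ∀ n (f : Subset (suc n) → ℕ) →
    ∑ (allSubsets (suc n)) f ≡ ∑ (allSubsets n) (f ∘ (true ∷_)) + ∑ (allSubsets n) (f ∘ (false ∷_))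
  branches n f = trans (∑-++ (map (true ∷_) (allSubsets n)) _ f)
    (cong₂ _+_ (∑-map (allSubsets n) (true ∷_) f) (∑-map (allSubsets n) (false ∷_) f))
  go : ∀ n (f : Subset n → ℕ) a → ∑[ x ∈ allSubsets n ] (⟦ does (x ≟ˢ a) ⟧ * f x) ≡ f a
  go zero f [] = trans (+-identityʳ (1 * f [])) (*-identityˡ (f []))
  go (suc n) f (true ∷ a) = trans (branches n (λ x → ⟦ does (x ≟ˢ (true ∷ a)) ⟧ * f x))
    (trans (cong₂ _+_ (go n (f ∘ (true ∷_)) a) (∑-0 (allSubsets n))) (+-identityʳ _))
  go (suc n) f (false ∷ a) = trans (branches n (λ x → ⟦ does (x ≟ˢ (false ∷ a)) ⟧ * f x))
    (cong₂ _+_ (∑-0 (allSubsets n)) (go n (f ∘ (false ∷_)) a))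

numEdges≡∑ : ∀ {n} (h : Hypergraph n) → numEdges h ≡ ∑[ e ∈ allSubsets n ] ⟦ h e ⟧
numEdges≡∑ {n} h = go (allSubsets n)
  where
  go : ∀ L → length (filterᵇ h L) ≡ ∑[ e ∈ L ] ⟦ h e ⟧
  go [] = refl
  go (e ∷ L) with h e
  ... | true = cong suc (go L)
  ... | false = go L

card≡∑ : ∀ {n} (e : Subset n) → ∣ e ∣ ≡ ∑[ v ∈ allFin n ] ⟦ lookup e v ⟧
card≡∑ [] = refl
card≡∑ {suc n} (b ∷ e) = trans (count-∷ b) (cong (⟦ b ⟧ +_) (trans (card≡∑ e) (sym tail)))
  where
  count-∷ : ∀ b → ∣ b ∷ e ∣ ≡ ⟦ b ⟧ + ∣ e ∣
  count-∷ true = refl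
  count-∷ false = refl
  tail : ∑[ v ∈ tabulate suc ] ⟦ lookup (b ∷ e) v ⟧ ≡ ∑[ v ∈ allFin n ] ⟦ lookup e v ⟧
  tail = trans (cong (λ L → ∑[ v ∈ L ] ⟦ lookup (b ∷ e) v ⟧) (sym (map-tabulate (λ x → x) suc)))
    (∑-map (allFin n) suc (λ v → ⟦ lookup (b ∷ e) v ⟧))

-- Two polynomial inequalities

-- With d = 5 + k, the threshold on m(h) is M / N, where M = 2d − 1 and N = 2d² − 5d + 5.
M N : ℕ → ℕ
M k = 9 + 2 * k
N k = 30 + 15 * k + 2 * (k * k)

-- For one edge of F: `s₁` and `s₂` count its vertices of degree 1 and 2, and `p` its ordered
-- private pairs. The factor 2d + 4 s₁ + s₂ is six times the demand on the edge. For d = 5 equality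
-- occurs, for instance at s₁ = s₂ = p = 0 and at s₁ = 0, s₂ = p = 1.
edge-inequality : ∀ k s₁ s₂ p → s₁ + s₂ ℕ.≤ 5 + k →
  (5 + k) * s₁ + (5 + k) * s₁ ℕ.≤ p + (s₁ + s₁ * s₁) →
  (1 ℕ.≤ s₂ → 1 ℕ.≤ p × s₂ + s₂ ℕ.≤ p + 2) →
  M k * (2 * (5 + k) + 4 * s₁ + s₂) ℕ.≤ 3 * N k + 9 * p
edge-inequality k zero zero p _ _ _ = begin
  (9 + 2 * k) * (2 * (5 + k) + 4 * 0 + 0)
    ≤⟨ m≤m+n _ (7 * k + 2 * (k * k)) ⟩
  (9 + 2 * k) * (2 * (5 + k) + 4 * 0 + 0) + (7 * k + 2 * (k * k))
    ≡⟨ identity k ⟩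
  3 * (30 + 15 * k + 2 * (k * k))
    ≤⟨ m≤m+n _ (9 * p) ⟩
  3 * (30 + 15 * k + 2 * (k * k)) + 9 * p ∎
  where
  open ≤-Reasoning
  identity : ∀ k → (9 + 2 * k) * (2 * (5 + k) + 4 * 0 + 0) + (7 * k + 2 * (k * k))
    ≡ 3 * (30 + 15 * k + 2 * (k * k))
  identity = solve-∀
edge-inequality k zero (suc zero) p _ _ two = begin
  (9 + 2 * k) * (2 * (5 + k) + 4 * 0 + 1)
    ≤⟨ m≤m+n _ (5 * k + 2 * (k * k)) ⟩
  (9 + 2 * k) * (2 * (5 + k) + 4 * 0 + 1) + (5 * k + 2 * (k * k))
    ≡⟨ identity k ⟩
  3 * (30 + 15 * k + 2 * (k * k)) + 9 * 1
    ≤⟨ +-monoʳ-≤ (3 * (30 + 15 * k + 2 * (k * k))) (*-monoʳ-≤ 9 (proj₁ (two (s≤s z≤n)))) ⟩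
  3 * (30 + 15 * k + 2 * (k * k)) + 9 * p ∎
  where
  open ≤-Reasoning
  identity : ∀ k → (9 + 2 * k) * (2 * (5 + k) + 4 * 0 + 1) + (5 * k + 2 * (k * k))
    ≡ 3 * (30 + 15 * k + 2 * (k * k)) + 9 * 1
  identity = solve-∀
edge-inequality k zero (suc (suc r)) p card _ two = begin
  (9 + 2 * k) * (2 * (5 + k) + 4 * 0 + (2 + r))
    ≡⟨ identity₁ k r ⟩
  108 + 42 * k + 4 * (k * k) + 9 * r + 2 * (k * r)
    ≤⟨ +-monoʳ-≤ (108 + 42 * k + 4 * (k * k) + 9 * r) 2kr≤ ⟩
  108 + 42 * k + 4 * (k * k) + 9 * r + (3 * k + 2 * (k * k) + 9 * r)
    ≡⟨ identity₂ k r ⟩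
  3 * (30 + 15 * k + 2 * (k * k)) + 9 * (2 + (r + r))
    ≤⟨ +-monoʳ-≤ (3 * (30 + 15 * k + 2 * (k * k))) (*-monoʳ-≤ 9 2+2r≤p) ⟩
  3 * (30 + 15 * k + 2 * (k * k)) + 9 * p ∎
  where
  open ≤-Reasoning
  identity₁ : ∀ k r → (9 + 2 * k) * (2 * (5 + k) + 4 * 0 + (2 + r))
    ≡ 108 + 42 * k + 4 * (k * k) + 9 * r + 2 * (k * r)
  identity₁ = solve-∀
  identity₂ : ∀ k r → 108 + 42 * k + 4 * (k * k) + 9 * r + (3 * k + 2 * (k * k) + 9 * r)
    ≡ 3 * (30 + 15 * k + 2 * (k * k)) + 9 * (2 + (r + r))
  identity₂ = solve-∀
  shift : ∀ r → 2 + (2 + (r + r)) ≡ suc (suc r) + suc (suc r)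
  shift = solve-∀
  2+2r≤p : 2 + (r + r) ℕ.≤ p
  2+2r≤p = +-cancelˡ-≤ 2 _ _ (begin
    2 + (2 + (r + r))         ≡⟨ shift r ⟩
    suc (suc r) + suc (suc r) ≤⟨ proj₂ (two (s≤s z≤n)) ⟩
    p + 2                     ≡⟨ +-comm p 2 ⟩
    2 + p                     ∎)
  2kr≤ : 2 * (k * r) ℕ.≤ 3 * k + 2 * (k * k) + 9 * r
  -- For r ≤ k the term 2k² suffices. Otherwise s₂ ≤ d gives r ≤ k + 3; the extra 6k is split into
  -- 3k + 3k, and the second half is paid by 9r because k < r.
  2kr≤ with r ℕ.≤? k
  ... | yes r≤k = begin
    2 * (k * r)                   ≤⟨ *-monoʳ-≤ 2 (*-monoʳ-≤ k r≤k) ⟩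
    2 * (k * k)                   ≤⟨ m≤n+m _ (3 * k) ⟩
    3 * k + 2 * (k * k)           ≤⟨ m≤m+n _ (9 * r) ⟩
    3 * k + 2 * (k * k) + 9 * r   ∎
  ... | no r≰k = begin
    2 * (k * r)                   ≤⟨ *-monoʳ-≤ 2 (*-monoʳ-≤ k (ℕ.s≤s⁻¹ (ℕ.s≤s⁻¹ card))) ⟩
    2 * (k * (3 + k))             ≡⟨ expand k ⟩
    3 * k + 2 * (k * k) + 3 * k   ≤⟨ +-monoʳ-≤ (3 * k + 2 * (k * k))
      (*-mono-≤ {3} {9} (s≤s (s≤s (s≤s z≤n))) (<⇒≤ (≰⇒> r≰k))) ⟩
    3 * k + 2 * (k * k) + 9 * r   ∎
    where
    expand : ∀ k → 2 * (k * (3 + k)) ≡ 3 * k + 2 * (k * k) + 3 * k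
    expand = solve-∀
-- Here `one` says p ≥ 2 d s₁ - s₁ - s₁²; adding 9 `Q` to both sides avoids the subtraction. The
-- bound s₁ + s₂ ≤ d then eliminates s₂, and what remains to be seen nonnegative is 3t(12 + 4k -
-- 3t).
edge-inequality k (suc t) s₂ p card one _ = +-cancelʳ-≤ (9 * Q) _ _ (begin
  (9 + 2 * k) * (2 * (5 + k) + 4 * suc t + s₂) + 9 * Q
    ≡⟨ regroup k t s₂ ⟩
  (9 + 2 * k) * (suc t + s₂) + R
    ≤⟨ +-monoˡ-≤ R (*-monoʳ-≤ (9 + 2 * k) card) ⟩
  (9 + 2 * k) * (5 + k) + R
    ≤⟨ +-cancelʳ-≤ (3 * t * (12 + 4 * k)) _ _ slack ⟩
  3 * (30 + 15 * k + 2 * (k * k)) + 9 * ((5 + k) * suc t + (5 + k) * suc t)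
    ≤⟨ +-monoʳ-≤ (3 * (30 + 15 * k + 2 * (k * k))) (*-monoʳ-≤ 9 one) ⟩
  3 * (30 + 15 * k + 2 * (k * k)) + 9 * (p + Q)
    ≡⟨ cong (_+_ (3 * (30 + 15 * k + 2 * (k * k)))) (*-distribˡ-+ 9 p Q) ⟩
  3 * (30 + 15 * k + 2 * (k * k)) + (9 * p + 9 * Q)
    ≡⟨ +-assoc (3 * (30 + 15 * k + 2 * (k * k))) (9 * p) (9 * Q) ⟨
  3 * (30 + 15 * k + 2 * (k * k)) + 9 * p + 9 * Q ∎)
  where
  open ≤-Reasoning
  Q R : ℕ
  Q = suc t + suc t * suc t
  R = (9 + 2 * k) * (2 * (5 + k) + 3 * suc t) + 9 * Q
  regroup : ∀ k t s → (9 + 2 * k) * (2 * (5 + k) + 4 * suc t + s) + 9 * (suc t + suc t * suc t)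
    ≡ (9 + 2 * k) * (suc t + s) + ((9 + 2 * k) * (2 * (5 + k) + 3 * suc t) + 9 * (suc t + suc t * suc t))
  regroup = solve-∀
  identity : ∀ k t → (9 + 2 * k) * (5 + k)
      + ((9 + 2 * k) * (2 * (5 + k) + 3 * suc t) + 9 * (suc t + suc t * suc t)) + 3 * t * (12 + 4 * k)
    ≡ 3 * (30 + 15 * k + 2 * (k * k)) + 9 * ((5 + k) * suc t + (5 + k) * suc t) + 3 * t * (3 * t)
  identity = solve-∀
  t≤ : t ℕ.≤ 4 + k
  t≤ = ℕ.s≤s⁻¹ (≤-trans (m≤m+n (suc t) s₂) card)
  3t≤ : 3 * t ℕ.≤ 12 + 4 * k
  3t≤ = begin
    3 * t        ≤⟨ *-monoʳ-≤ 3 t≤ ⟩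
    3 * (4 + k)  ≡⟨ *-distribˡ-+ 3 4 k ⟩
    12 + 3 * k   ≤⟨ +-monoʳ-≤ 12 (*-monoˡ-≤ k {3} {4} (s≤s (s≤s (s≤s z≤n)))) ⟩
    12 + 4 * k   ∎
  slack : (9 + 2 * k) * (5 + k) + R + 3 * t * (12 + 4 * k)
    ℕ.≤ 3 * (30 + 15 * k + 2 * (k * k)) + 9 * ((5 + k) * suc t + (5 + k) * suc t) + 3 * t * (12 + 4 * k)
  slack = ≤-trans (≤-reflexive (identity k t))
    (+-monoʳ-≤ (3 * (30 + 15 * k + 2 * (k * k)) + 9 * ((5 + k) * suc t + (5 + k) * suc t))
      (*-monoʳ-≤ (3 * t) 3t≤))

-- An edge with s vertices inside V and t outside accounts for the o = s² − s ordered pairs of its vertices inside V.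
-- The case s = d is the one that needs d ≥ 5.
gain-inequality : ∀ k s t o → 2 ℕ.≤ s → s + t ≡ 5 + k → o + s ≡ s * s → 2 * (M k * t) + 3 * o ℕ.≤ 2 * N k
gain-inequality k (suc (suc r)) t o (s≤s (s≤s z≤n)) card o+s = +-cancelʳ-≤ (2 * ((9 + 2 * k) * r) + 6) _ _ (begin
  2 * ((9 + 2 * k) * t) + 3 * o + (2 * ((9 + 2 * k) * r) + 6)
    ≡⟨ cong (λ o → 2 * ((9 + 2 * k) * t) + 3 * o + (2 * ((9 + 2 * k) * r) + 6)) o≡ ⟩
  2 * ((9 + 2 * k) * t) + 3 * ((2 + r) * (1 + r)) + (2 * ((9 + 2 * k) * r) + 6)
    ≡⟨ regroup k t r ⟩
  2 * ((9 + 2 * k) * (r + t)) + 12 + (9 * r + 3 * r * r)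
    ≡⟨ cong (λ m → 2 * ((9 + 2 * k) * m) + 12 + (9 * r + 3 * r * r)) r+t ⟩
  2 * ((9 + 2 * k) * (3 + k)) + 12 + (9 * r + 3 * r * r)
    ≤⟨ +-monoʳ-≤ (2 * ((9 + 2 * k) * (3 + k)) + 12) (+-monoʳ-≤ (9 * r) (*-monoˡ-≤ r 3r≤)) ⟩
  2 * ((9 + 2 * k) * (3 + k)) + 12 + (9 * r + (9 + 4 * k) * r)
    ≡⟨ identity k r ⟩
  2 * (30 + 15 * k + 2 * (k * k)) + (2 * ((9 + 2 * k) * r) + 6) ∎)
  where
  open ≤-Reasoning
  r+t : r + t ≡ 3 + k
  r+t = suc-injective (suc-injective card)
  square : ∀ r → (2 + r) * (2 + r) ≡ (2 + r) * (1 + r) + (2 + r)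
  square = solve-∀
  o≡ : o ≡ (2 + r) * (1 + r)
  o≡ = +-cancelʳ-≡ (2 + r) _ _ (trans o+s (square r))
  regroup : ∀ k t r → 2 * ((9 + 2 * k) * t) + 3 * ((2 + r) * (1 + r)) + (2 * ((9 + 2 * k) * r) + 6)
    ≡ 2 * ((9 + 2 * k) * (r + t)) + 12 + (9 * r + 3 * r * r)
  regroup = solve-∀
  identity : ∀ k r → 2 * ((9 + 2 * k) * (3 + k)) + 12 + (9 * r + (9 + 4 * k) * r)
    ≡ 2 * (30 + 15 * k + 2 * (k * k)) + (2 * ((9 + 2 * k) * r) + 6)
  identity = solve-∀
  -- Once t is eliminated through r + t = 3 + k, the two sides differ by r(9 + 4k - 3r).
  3r≤ : 3 * r ℕ.≤ 9 + 4 * k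
  3r≤ = begin
    3 * r       ≤⟨ *-monoʳ-≤ 3 (≤-trans (m≤m+n r t) (≤-reflexive r+t)) ⟩
    3 * (3 + k) ≡⟨ *-distribˡ-+ 3 3 k ⟩
    9 + 3 * k   ≤⟨ +-monoʳ-≤ 9 (*-monoˡ-≤ k {3} {4} (s≤s (s≤s (s≤s z≤n)))) ⟩
    9 + 4 * k   ∎

-- Indicators and membership in subsets

⟦⟧-pos : ∀ b → 1 ℕ.≤ ⟦ b ⟧ → b ≡ true
⟦⟧-pos true _ = refl

*-pos : ∀ m n → 1 ℕ.≤ m * n → 1 ℕ.≤ m × 1 ℕ.≤ n
*-pos (suc m) (suc n) _ = s≤s z≤n , s≤s z≤n
*-pos (suc m) zero p = ⊥-elim (1+n≰n (≤-trans p (≤-reflexive (*-zeroʳ m))))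

is+ is1 is2 : ℕ → ℕ
is+ zero = 0
is+ (suc _) = 1
is1 1 = 1
is1 _ = 0
is2 2 = 1
is2 _ = 0

is+≡1 : ∀ {m} → 1 ℕ.≤ m → is+ m ≡ 1
is+≡1 (s≤s _) = refl

is1-pos : ∀ m → 1 ℕ.≤ is1 m → m ≡ 1
is1-pos 1 _ = refl

is2-pos : ∀ m → 1 ℕ.≤ is2 m → m ≡ 2
is2-pos 2 _ = refl

is2≤1 : ∀ m → is2 m ℕ.≤ 1
is2≤1 0 = z≤n
is2≤1 1 = z≤n
is2≤1 2 = ≤-refl
is2≤1 (suc (suc (suc _))) = z≤n

is1+is2≤1 : ∀ m → is1 m + is2 m ℕ.≤ 1
is1+is2≤1 0 = z≤n
is1+is2≤1 1 = ≤-refl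
is1+is2≤1 2 = ≤-refl
is1+is2≤1 (suc (suc (suc _))) = z≤n

is1-01 : ∀ m → is1 m ≡ 0 ⊎ is1 m ≡ 1
is1-01 0 = inj₁ refl
is1-01 1 = inj₂ refl
is1-01 (suc (suc _)) = inj₁ refl

-- A vertex of degree m asks each of its m edges for 1/m when m ≤ 2 and for 1/3 otherwise; in sixths, 2 + 4 is1 m + is2 m.
is+≤weight : ∀ m → 6 * is+ m ℕ.≤ m * (2 + 4 * is1 m + is2 m)
is+≤weight 0 = z≤n
is+≤weight 1 = ≤-refl
is+≤weight 2 = ≤-refl
is+≤weight (suc (suc (suc m))) = m≤m+n 6 (m * 2)

∈⇒lookup : ∀ {n} {e : Subset n} {v} → v ∈ e → lookup e v ≡ true
∈⇒lookup = Vec.[]=⇒lookup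

lookup⇒∈ : ∀ {n} (e : Subset n) v → lookup e v ≡ true → v ∈ e
lookup⇒∈ e v = Vec.lookup⇒[]= v e

-- Otherwise `e` is contained in `f`; the containment cannot be proper because the sizes agree, so
-- the sets would be equal.
∃∈∉ : ∀ {n} (e f : Subset n) → ∣ e ∣ ≡ ∣ f ∣ → e ≢ f → ∃ λ x → lookup e x ≡ true × lookup f x ≡ false
∃∈∉ e f eq e≢f with any? (λ x → (x ∈? e) ×-dec ¬? (x ∈? f))
... | yes (x , x∈e , x∉f) = x , ∈⇒lookup x∈e , outside-f
  where
  outside-f : lookup f x ≡ false
  outside-f with lookup f x in x∈f
  ... | true = ⊥-elim (x∉f (lookup⇒∈ f x x∈f))
  ... | false = refl
... | no none = ⊥-elim (e≢f (⊆-antisym e⊆f f⊆e))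
  where
  e⊆f : ∀ {x} → x ∈ e → x ∈ f
  e⊆f {x} x∈e = decidable-stable (x ∈? f) (λ x∉f → none (x , x∈e , x∉f))
  f⊆e : ∀ {x} → x ∈ f → x ∈ e
  f⊆e {x} x∈f = decidable-stable (x ∈? e)
    (λ x∉e → <-irrefl eq (p⊂q⇒∣p∣<∣q∣ (e⊆f , x , x∈f , x∉e)))

-- Hypergraphs and their private pairs

module Family {n : ℕ} (F : Hypergraph n) where

  Vs : List (Fin n)
  Vs = allFin n

  Es : List (Subset n)
  Es = allSubsets n

  open Enumeration (finE n) public using () renaming
    ( once to onceᵛ; _except_ to _exceptᵛ_; split₂ to split₂ᵛ; term≤∑ to term≤∑ᵛ
    ; except-mono to except-monoᵛ )
  open Enumeration (subsetE n) public using () renaming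
    ( except-pos to except-posᵉ; split to splitᵉ; _except_ to _exceptᵉ_
    ; terms₂≤∑ to terms₂≤∑ᵉ; terms₃≤∑ to terms₃≤∑ᵉ )

  χ : Subset n → Fin n → ℕ
  χ e v = ⟦ lookup e v ⟧

  deg : Fin n → ℕ
  deg v = ∑[ e ∈ Es ] (⟦ F e ⟧ * χ e v)

  codeg : Fin n → Fin n → ℕ
  codeg u v = ∑[ e ∈ Es ] (⟦ F e ⟧ * (χ e u * χ e v))

  -- The first factor excludes u = v, where `codeg` is just the degree and may well be 1.
  isPrivate : Fin n → Fin n → ℕ
  isPrivate u v = ⟦ not (does (u ≟ᶠ v)) ⟧ * is1 (codeg u v)

  Through : Fin n → Subset n → Set
  Through v e = F e ≡ true × lookup e v ≡ true

  through-1 : ∀ {v e} → Through v e → ⟦ F e ⟧ * χ e v ≡ 1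
  through-1 (p , q) rewrite p | q = refl

  through-pos : ∀ {v e} → 1 ℕ.≤ ⟦ F e ⟧ * χ e v → Through v e
  through-pos {v} {e} p with *-pos ⟦ F e ⟧ (χ e v) p
  ... | p₁ , p₂ = ⟦⟧-pos _ p₁ , ⟦⟧-pos _ p₂

  through₂-1 : ∀ {u v e} → Through u e → Through v e → ⟦ F e ⟧ * (χ e u * χ e v) ≡ 1
  through₂-1 (p , q) (_ , r) rewrite p | q | r = refl

  through₂-pos : ∀ {u v e} → 1 ℕ.≤ ⟦ F e ⟧ * (χ e u * χ e v) → Through u e × Through v e
  through₂-pos {u} {v} {e} p with *-pos ⟦ F e ⟧ (χ e u * χ e v) p
  ... | p₁ , p₂ with *-pos (χ e u) (χ e v) p₂
  ... | p₃ , p₄ = (⟦⟧-pos _ p₁ , ⟦⟧-pos _ p₃) , (⟦⟧-pos _ p₁ , ⟦⟧-pos _ p₄)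

  -- Edges through vertices of degree 1 and 2

  deg-1-unique : ∀ {v e f} → deg v ≡ 1 → Through v e → Through v f → f ≡ e
  deg-1-unique {v} {e} {f} eq te tf with f ≟ˢ e
  ... | yes f≡e = f≡e
  ... | no f≢e = ⊥-elim (1+n≰n (≤-trans
    (≤-reflexive (sym (cong₂ _+_ (through-1 te) (through-1 tf))))
    (≤-trans (terms₂≤∑ᵉ (λ z → ⟦ F z ⟧ * χ z v) f≢e) (≤-reflexive eq))))

  deg-2-other : ∀ {v e} → deg v ≡ 2 → Through v e → ∃ λ f → f ≢ e × Through v f
  deg-2-other {v} {e} eq te with ∑-pos Es (φ exceptᵉ e) rest
    where
    φ : Subset n → ℕ
    φ z = ⟦ F z ⟧ * χ z v
    rest : 1 ℕ.≤ ∑ Es (φ exceptᵉ e)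
    rest = ≤-reflexive (suc-injective (trans (sym eq) (trans (splitᵉ φ e)
      (cong (_+ ∑ Es (φ exceptᵉ e)) (through-1 te)))))
  ... | f , p with except-posᵉ (λ z → ⟦ F z ⟧ * χ z v) e f p
  ... | f≢e , q = f , f≢e , through-pos q

  deg-2-only : ∀ {v e f z} → deg v ≡ 2 → f ≢ e → Through v e → Through v f → Through v z →
    z ≡ e ⊎ z ≡ f
  deg-2-only {v} {e} {f} {z} eq f≢e te tf tz with z ≟ˢ e | z ≟ˢ f
  ... | yes z≡e | _ = inj₁ z≡e
  ... | no _ | yes z≡f = inj₂ z≡f
  ... | no z≢e | no z≢f = ⊥-elim (1+n≰n (≤-trans
    (≤-reflexive (sym (cong₂ _+_ (through-1 te) (cong₂ _+_ (through-1 tf) (through-1 tz)))))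
    (≤-trans (terms₃≤∑ᵉ (λ y → ⟦ F y ⟧ * χ y v) f≢e z≢e z≢f) (≤-reflexive eq))))

  -- Any positive term left after splitting off `e` would be another edge through both vertices.
  codeg-1 : ∀ {u v e} → Through u e → Through v e →
    (∀ f → Through u f → Through v f → f ≡ e) → codeg u v ≡ 1
  codeg-1 {u} {v} {e} ue ve only = trans (splitᵉ φ e) (cong₂ _+_ (through₂-1 ue ve) rest)
    where
    φ : Subset n → ℕ
    φ z = ⟦ F z ⟧ * (χ z u * χ z v)
    no-other : ¬ (1 ℕ.≤ ∑ Es (φ exceptᵉ e))
    no-other p with ∑-pos Es (φ exceptᵉ e) p
    ... | f , q with except-posᵉ φ e f q
    ... | f≢e , r with through₂-pos r
    ... | uf , vf = f≢e (only f uf vf)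
    rest : ∑ Es (φ exceptᵉ e) ≡ 0
    rest = n<1⇒n≡0 (≰⇒> no-other)

  private-1 : ∀ {u v e} → u ≢ v → Through u e → Through v e →
    (∀ f → Through u f → Through v f → f ≡ e) → isPrivate u v ≡ 1
  private-1 {u} {v} u≢v ue ve only
    rewrite dec-false (u ≟ᶠ v) u≢v | codeg-1 ue ve only = refl

  private-sym : ∀ u v → isPrivate u v ≡ isPrivate v u
  private-sym u v = cong₂ (λ b m → ⟦ not b ⟧ * is1 m) does-sym
    (∑-cong Es (λ e → cong (⟦ F e ⟧ *_) (*-comm (χ e u) (χ e v))))
    where
    does-sym : does (u ≟ᶠ v) ≡ does (v ≟ᶠ u)
    does-sym with v ≟ᶠ u
    ... | yes refl = dec-true (u ≟ᶠ u) refl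
    ... | no v≢u = dec-false (u ≟ᶠ v) (v≢u ∘ sym)

  private-pos : ∀ {u v} → 1 ℕ.≤ isPrivate u v → u ≢ v × codeg u v ≡ 1
  private-pos {u} {v} p with u ≟ᶠ v
  ... | no u≢v = u≢v , is1-pos (codeg u v) (≤-trans p (≤-reflexive (*-identityˡ _)))

  -- Private pairs are counted as ordered pairs.
  pairs : ℕ
  pairs = ∑[ u ∈ Vs ] ∑[ v ∈ Vs ] isPrivate u v

  pairsAt : Subset n → Fin n → ℕ
  pairsAt e u = ∑[ v ∈ Vs ] (χ e v * isPrivate u v)

  pairsIn : Subset n → ℕ
  pairsIn e = ∑[ u ∈ Vs ] (χ e u * pairsAt e u)

  s₁ s₂ : Subset n → ℕ
  s₁ e = ∑[ v ∈ Vs ] (χ e v * is1 (deg v))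
  s₂ e = ∑[ v ∈ Vs ] (χ e v * is2 (deg v))

  s₁+s₂≤card : ∀ e → s₁ e + s₂ e ℕ.≤ ∣ e ∣
  s₁+s₂≤card e = begin
    s₁ e + s₂ e                                         ≡⟨ ∑-+ Vs _ _ ⟨
    ∑[ v ∈ Vs ] (χ e v * is1 (deg v) + χ e v * is2 (deg v))
      ≤⟨ ∑-mono Vs (λ v → ≤-trans (≤-reflexive (sym (*-distribˡ-+ (χ e v) _ _)))
           (≤-trans (*-monoʳ-≤ (χ e v) (is1+is2≤1 (deg v))) (≤-reflexive (*-identityʳ (χ e v))))) ⟩
    ∑[ v ∈ Vs ] χ e v                                   ≡⟨ card≡∑ e ⟨
    ∣ e ∣                                               ∎
    where open ≤-Reasoning

  -- Every pair in e that meets a vertex of degree 1 is private.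
  pairsIn-deg-1 : ∀ e → F e ≡ true →
    ∣ e ∣ * s₁ e + ∣ e ∣ * s₁ e ℕ.≤ pairsIn e + (s₁ e + s₁ e * s₁ e)
  pairsIn-deg-1 e Fe = begin
    ∣ e ∣ * s₁ e + ∣ e ∣ * s₁ e
      ≡⟨ cong₂ _+_ (trans (*-comm ∣ e ∣ (s₁ e)) (cong (s₁ e *_) (card≡∑ e)))
                   (cong (_* s₁ e) (card≡∑ e)) ⟩
    ∑ Vs α * ∑ Vs (χ e) + ∑ Vs (χ e) * ∑ Vs α
      ≡⟨ cong₂ _+_ (∑∑-* α (χ e)) (∑∑-* (χ e) α) ⟨
    ∑[ u ∈ Vs ] ∑[ v ∈ Vs ] (α u * χ e v) + ∑[ u ∈ Vs ] ∑[ v ∈ Vs ] (χ e u * α v)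
      ≡⟨ ∑∑-+ _ _ ⟨
    ∑[ u ∈ Vs ] ∑[ v ∈ Vs ] (α u * χ e v + χ e u * α v)
      ≤⟨ ∑-mono Vs (λ u → ∑-mono Vs (pointwise u)) ⟩
    ∑[ u ∈ Vs ] ∑[ v ∈ Vs ] (χ e u * (χ e v * isPrivate u v) + (⟦ does (v ≟ᶠ u) ⟧ * α v + α u * α v))
      ≡⟨ trans (∑∑-+ _ _) (cong (∑[ u ∈ Vs ] ∑[ v ∈ Vs ] (χ e u * (χ e v * isPrivate u v)) +_) (∑∑-+ _ _)) ⟩
    ∑[ u ∈ Vs ] ∑[ v ∈ Vs ] (χ e u * (χ e v * isPrivate u v))
      + (∑[ u ∈ Vs ] ∑[ v ∈ Vs ] (⟦ does (v ≟ᶠ u) ⟧ * α v) + ∑[ u ∈ Vs ] ∑[ v ∈ Vs ] (α u * α v))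
      ≡⟨ cong₂ _+_ (∑-cong Vs (λ u → ∑-*ˡ Vs (χ e u) _))
           (cong₂ _+_ (∑-cong Vs (λ u → onceᵛ α u)) (∑∑-* α α)) ⟩
    pairsIn e + (s₁ e + s₁ e * s₁ e) ∎
    where
    open ≤-Reasoning
    α : Fin n → ℕ
    α v = χ e v * is1 (deg v)
    ∑∑-* : ∀ (f g : Fin n → ℕ) → ∑[ u ∈ Vs ] ∑[ v ∈ Vs ] (f u * g v) ≡ ∑ Vs f * ∑ Vs g
    ∑∑-* f g = trans (∑-cong Vs (λ u → ∑-*ˡ Vs (f u) g)) (∑-*ʳ Vs (∑ Vs g) f)
    ∑∑-+ : ∀ (f g : Fin n → Fin n → ℕ) → ∑[ u ∈ Vs ] ∑[ v ∈ Vs ] (f u v + g u v)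
      ≡ ∑[ u ∈ Vs ] ∑[ v ∈ Vs ] f u v + ∑[ u ∈ Vs ] ∑[ v ∈ Vs ] g u v
    ∑∑-+ f g = trans (∑-cong Vs (λ u → ∑-+ Vs (f u) (g u))) (∑-+ Vs _ _)
    private-at-1 : ∀ {u v} → u ≢ v → Through u e → Through v e → 1 ℕ.≤ is1 (deg u) → isPrivate u v ≡ 1
    private-at-1 u≢v ue ve p = private-1 u≢v ue ve (λ f uf _ → deg-1-unique (is1-pos _ p) ue uf)
    private-at-1′ : ∀ {u v} → u ≢ v → Through u e → Through v e → 1 ℕ.≤ is1 (deg v) → isPrivate u v ≡ 1
    private-at-1′ u≢v ue ve p = private-1 u≢v ue ve (λ f _ vf → deg-1-unique (is1-pos _ p) ve vf)
    diagonal : ∀ b m → ⟦ b ⟧ * is1 m * ⟦ b ⟧ + ⟦ b ⟧ * (⟦ b ⟧ * is1 m)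
      ℕ.≤ 1 * (⟦ b ⟧ * is1 m) + ⟦ b ⟧ * is1 m * (⟦ b ⟧ * is1 m)
    diagonal false m = z≤n
    diagonal true 0 = z≤n
    diagonal true 1 = ≤-refl
    diagonal true (suc (suc m)) = z≤n
    -- Inclusion-exclusion for a single ordered pair. If both ends have degree 1 the pair is counted
    -- twice on the left, and `α u * α v` pays for the second count. On the diagonal the left side
    -- is 2 `α u`, paid by the delta term and by `α u * α u`.
    pointwise : ∀ u v → α u * χ e v + χ e u * α v
      ℕ.≤ χ e u * (χ e v * isPrivate u v) + (⟦ does (v ≟ᶠ u) ⟧ * α v + α u * α v)
    pointwise u v with v ≟ᶠ u
    ... | yes refl = ≤-trans (diagonal (lookup e u) (deg u))
      (m≤n+m _ (χ e u * (χ e u * isPrivate u u)))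
    ... | no v≢u with lookup e u in u∈e | lookup e v in v∈e
    ... | false | _ = z≤n
    ... | true | false = ≤-trans (≤-reflexive (trans (+-identityʳ _) (*-zeroʳ (1 * is1 (deg u))))) z≤n
    ... | true | true with is1-01 (deg u) | is1-01 (deg v)
    ... | inj₁ p | inj₁ q rewrite p | q = z≤n
    ... | inj₁ p | inj₂ q
      rewrite p | q | private-at-1′ (v≢u ∘ sym) (Fe , u∈e) (Fe , v∈e) (≤-reflexive (sym q)) = ≤-refl
    ... | inj₂ p | q₀
      rewrite p | private-at-1 (v≢u ∘ sym) (Fe , u∈e) (Fe , v∈e) (≤-reflexive (sym p)) with q₀
    ... | inj₁ q rewrite q = ≤-refl
    ... | inj₂ q rewrite q = ≤-refl

  -- If v has degree 2, lying in e and f, choose x in e outside f. The second edge through a vertex u of degree 2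
  -- misses x, or else differs from f and so misses v; hence one of the pairs {u,v}, {u,x} is private.
  pairsIn-deg-2 : ∀ e → F e ≡ true → (∀ f → F f ≡ true → ∣ f ∣ ≡ ∣ e ∣) → 1 ℕ.≤ s₂ e →
    1 ℕ.≤ pairsIn e × s₂ e + s₂ e ℕ.≤ pairsIn e + 2
  pairsIn-deg-2 e Fe uniform pos with ∑-pos Vs (λ v → χ e v * is2 (deg v)) pos
  ... | v , p with *-pos (χ e v) (is2 (deg v)) p
  ... | p₁ , p₂ with ⟦⟧-pos (lookup e v) p₁ | is2-pos (deg v) p₂
  ... | v∈e | deg-v with deg-2-other deg-v (Fe , v∈e)
  ... | f , f≢e , (Ff , v∈f) with ∃∈∉ e f (sym (uniform f Ff)) (f≢e ∘ sym)
  ... | x , x∈e , x∉f = one≤ , double≤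
    where
    open ≤-Reasoning
    β φ : Fin n → ℕ
    β u = χ e u * is2 (deg u)
    φ u = χ e u * pairsAt e u

    true≢false : true ≢ false
    true≢false ()

    x≢v : x ≢ v
    x≢v refl = true≢false (trans (sym v∈f) x∉f)

    only-vx : ∀ z → Through v z → Through x z → z ≡ e
    only-vx z vz xz with deg-2-only deg-v f≢e (Fe , v∈e) (Ff , v∈f) vz
    ... | inj₁ z≡e = z≡e
    ... | inj₂ refl = ⊥-elim (true≢false (trans (sym (proj₂ xz)) x∉f))

    vx : isPrivate v x ≡ 1
    vx = private-1 (x≢v ∘ sym) (Fe , v∈e) (Fe , x∈e) only-vx

    xv : isPrivate x v ≡ 1
    xv = trans (private-sym x v) vx

    neighbour : ∀ u → Dec (u ≡ v) → Dec (u ≡ x) → lookup e u ≡ true → deg u ≡ 2 →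
      1 ℕ.≤ isPrivate u v + isPrivate u x
    -- The vertices v and x serve each other, since {v, x} is private.
    neighbour u (yes refl) _ _ _ = ≤-trans (≤-reflexive (sym vx)) (m≤n+m _ (isPrivate u u))
    neighbour u (no _) (yes refl) _ _ = ≤-trans (≤-reflexive (sym xv)) (m≤m+n _ _)
    neighbour u (no u≢v) (no u≢x) u∈e deg-u with deg-2-other deg-u (Fe , u∈e)
    ... | g , g≢e , (Fg , u∈g) with lookup g x in x∈?g
    ... | false = ≤-trans (≤-reflexive (sym ux)) (m≤n+m _ (isPrivate u v))
      where
      only : ∀ z → Through u z → Through x z → z ≡ e
      only z uz xz with deg-2-only deg-u g≢e (Fe , u∈e) (Fg , u∈g) uz
      ... | inj₁ z≡e = z≡e
      ... | inj₂ refl = ⊥-elim (true≢false (trans (sym (proj₂ xz)) x∈?g))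
      ux : isPrivate u x ≡ 1
      ux = private-1 u≢x (Fe , u∈e) (Fe , x∈e) only
    ... | true = ≤-trans (≤-reflexive (sym uv)) (m≤m+n _ _)
      where
      only : ∀ z → Through u z → Through v z → z ≡ e
      only z uz vz with deg-2-only deg-u g≢e (Fe , u∈e) (Fg , u∈g) uz
      ... | inj₁ z≡e = z≡e
      ... | inj₂ refl with deg-2-only deg-v f≢e (Fe , v∈e) (Ff , v∈f) vz
      ... | inj₁ z≡e = z≡e
      ... | inj₂ refl = ⊥-elim (true≢false (trans (sym x∈?g) x∉f))
      uv : isPrivate u v ≡ 1
      uv = private-1 u≢v (Fe , u∈e) (Fe , v∈e) only

    β≤ : ∀ u → β u ℕ.≤ χ e u * (isPrivate u v + isPrivate u x)
    β≤ u with lookup e u in u∈e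
    ... | false = z≤n
    ... | true with 1 ℕ.≤? is2 (deg u)
    ... | yes q = *-monoʳ-≤ 1 (≤-trans (is2≤1 (deg u)) (neighbour u (u ≟ᶠ v) (u ≟ᶠ x) u∈e (is2-pos (deg u) q)))
    ... | no ¬q = ≤-trans (≤-reflexive (trans (*-identityˡ _) (n<1⇒n≡0 (≰⇒> ¬q)))) z≤n

    β≤φ : ∀ u → β u ℕ.≤ φ u
    β≤φ u = ≤-trans (β≤ u) (*-monoʳ-≤ (χ e u) (begin
      isPrivate u v + isPrivate u x
        ≡⟨ cong₂ _+_ (weigh v v∈e) (weigh x x∈e) ⟩
      χ e v * isPrivate u v + χ e x * isPrivate u x
        ≤⟨ Enumeration.terms₂≤∑ (finE n) (λ w → χ e w * isPrivate u w) x≢v ⟩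
      pairsAt e u ∎))
      where
      weigh : ∀ w → lookup e w ≡ true → isPrivate u w ≡ χ e w * isPrivate u w
      weigh w w∈e rewrite w∈e = sym (*-identityˡ _)

    φ-at : ∀ w → lookup e w ≡ true → φ w ≡ pairsAt e w
    φ-at w w∈e rewrite w∈e = *-identityˡ _

    -- The degree-2 vertices are now counted twice, through disjoint sets of ordered pairs.
    -- Reversing the pair found by `neighbour` places it in the row of v or of x, so these two rows
    -- already account for all of `s₂ e`.
    s₂≤φv+φx : s₂ e ℕ.≤ φ v + φ x
    s₂≤φv+φx = begin
      s₂ e
        ≤⟨ ∑-mono Vs β≤ ⟩
      ∑[ u ∈ Vs ] (χ e u * (isPrivate u v + isPrivate u x))
        ≡⟨ ∑-cong Vs (λ u → trans (*-distribˡ-+ (χ e u) _ _)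
             (cong₂ (λ a b → χ e u * a + χ e u * b) (private-sym u v) (private-sym u x))) ⟩
      ∑[ u ∈ Vs ] (χ e u * isPrivate v u + χ e u * isPrivate x u)
        ≡⟨ ∑-+ Vs _ _ ⟩
      pairsAt e v + pairsAt e x
        ≡⟨ cong₂ _+_ (φ-at v v∈e) (φ-at x x∈e) ⟨
      φ v + φ x ∎

    ψ : (Fin n → ℕ) → ℕ
    ψ θ = ∑ Vs ((θ exceptᵛ v) exceptᵛ x)

    β≤1 : ∀ u → β u ℕ.≤ 1
    β≤1 u = *-mono-≤ (⟦⟧≤1 (lookup e u)) (is2≤1 (deg u))

    -- In the second count each vertex uses its own row. The rows of v and x are already spent,
    -- which loses at most 1 each; this is the 2 in the final bound.
    s₂≤2+rest : s₂ e ℕ.≤ 1 + (1 + ψ φ)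
    s₂≤2+rest = begin
      s₂ e              ≡⟨ split₂ᵛ β x≢v ⟩
      β v + (β x + ψ β) ≤⟨ +-mono-≤ (β≤1 v) (+-mono-≤ (β≤1 x)
        (∑-mono Vs (except-monoᵛ _ _ x (except-monoᵛ _ _ v β≤φ)))) ⟩
      1 + (1 + ψ φ)     ∎

    rearrange : ∀ a b c → a + b + (1 + (1 + c)) ≡ a + (b + c) + 2
    rearrange = solve-∀

    double≤ : s₂ e + s₂ e ℕ.≤ pairsIn e + 2
    double≤ = begin
      s₂ e + s₂ e                 ≤⟨ +-mono-≤ s₂≤φv+φx s₂≤2+rest ⟩
      φ v + φ x + (1 + (1 + ψ φ)) ≡⟨ rearrange (φ v) (φ x) (ψ φ) ⟩
      φ v + (φ x + ψ φ) + 2       ≡⟨ cong (_+ 2) (split₂ᵛ φ x≢v) ⟨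
      pairsIn e + 2               ∎

    one≤ : 1 ℕ.≤ pairsIn e
    one≤ = begin
      1            ≤⟨ *-mono-≤ p₁ p₂ ⟩
      β v          ≤⟨ β≤φ v ⟩
      φ v          ≤⟨ term≤∑ᵛ φ v ⟩
      pairsIn e    ∎

  -- After exchanging the sums each pair is weighted by its codegree, which is 1 whenever the pair
  -- is private.
  ∑-pairsIn : ∑[ e ∈ Es ] (⟦ F e ⟧ * pairsIn e) ℕ.≤ pairs
  ∑-pairsIn = begin
    ∑[ e ∈ Es ] (⟦ F e ⟧ * pairsIn e)
      ≡⟨ ∑-cong Es (λ e → trans (sym (∑-*ˡ Vs ⟦ F e ⟧ _)) (∑-cong Vs (λ u → inner e u))) ⟩
    ∑[ e ∈ Es ] ∑[ u ∈ Vs ] ∑[ v ∈ Vs ] (⟦ F e ⟧ * (χ e u * χ e v) * isPrivate u v)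
      ≡⟨ ∑-swap Es Vs _ ⟩
    ∑[ u ∈ Vs ] ∑[ e ∈ Es ] ∑[ v ∈ Vs ] (⟦ F e ⟧ * (χ e u * χ e v) * isPrivate u v)
      ≡⟨ ∑-cong Vs (λ u → trans (∑-swap Es Vs _) (∑-cong Vs (λ v → ∑-*ʳ Es (isPrivate u v) _))) ⟩
    ∑[ u ∈ Vs ] ∑[ v ∈ Vs ] (codeg u v * isPrivate u v)
      ≤⟨ ∑-mono Vs (λ u → ∑-mono Vs (λ v → *-is1 (codeg u v) ⟦ not (does (u ≟ᶠ v)) ⟧)) ⟩
    pairs ∎
    where
    open ≤-Reasoning
    assoc : ∀ a b c d → a * (b * (c * d)) ≡ a * (b * c) * d
    assoc = solve-∀
    inner : ∀ e u → ⟦ F e ⟧ * (χ e u * pairsAt e u)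
      ≡ ∑[ v ∈ Vs ] (⟦ F e ⟧ * (χ e u * χ e v) * isPrivate u v)
    inner e u = trans (cong (⟦ F e ⟧ *_) (sym (∑-*ˡ Vs (χ e u) _)))
      (trans (sym (∑-*ˡ Vs ⟦ F e ⟧ _)) (∑-cong Vs (λ v → assoc ⟦ F e ⟧ (χ e u) (χ e v) (isPrivate u v))))
    *-is1 : ∀ m b → m * (b * is1 m) ℕ.≤ b * is1 m
    *-is1 0 b = z≤n
    *-is1 1 b = ≤-reflexive (*-identityˡ (b * 1))
    *-is1 m@(suc (suc _)) b = ≤-reflexive (trans (cong (m *_) (*-zeroʳ b)) (trans (*-zeroʳ m) (sym (*-zeroʳ b))))

  -- Double counting of the demands in sixths: each vertex of V sends out at least 6, and
  -- `edge-inequality` bounds what one edge receives. The coefficient of `pairs` is 3 because each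
  -- unordered pair is counted twice; the common factor 3 of the summed edge inequalities cancels.
  vertices-bound : ∀ k → Uniform (5 + k) F →
    2 * (M k * ∑[ v ∈ Vs ] is+ (deg v)) ℕ.≤ N k * ∑[ e ∈ Es ] ⟦ F e ⟧ + 3 * pairs
  vertices-bound k uniform = *-cancelˡ-≤ 3 (begin
    3 * (2 * (M k * #V))
      ≡⟨ rearrange₁ (M k) #V ⟩
    M k * (6 * #V)
      ≤⟨ *-monoʳ-≤ (M k) demand ⟩
    M k * ∑[ e ∈ Es ] (⟦ F e ⟧ * W e)
      ≡⟨ ∑-*ˡ Es (M k) _ ⟨
    ∑[ e ∈ Es ] (M k * (⟦ F e ⟧ * W e))
      ≤⟨ ∑-mono Es supply ⟩
    ∑[ e ∈ Es ] (⟦ F e ⟧ * (3 * N k) + 9 * (⟦ F e ⟧ * pairsIn e))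
      ≡⟨ trans (∑-+ Es _ _) (cong₂ _+_ (∑-*ʳ Es (3 * N k) _) (∑-*ˡ Es 9 _)) ⟩
    #F * (3 * N k) + 9 * ∑[ e ∈ Es ] (⟦ F e ⟧ * pairsIn e)
      ≤⟨ +-monoʳ-≤ (#F * (3 * N k)) (*-monoʳ-≤ 9 ∑-pairsIn) ⟩
    #F * (3 * N k) + 9 * pairs
      ≡⟨ rearrange₂ #F (N k) pairs ⟩
    3 * (N k * #F + 3 * pairs) ∎)
    where
    open ≤-Reasoning
    #V #F : ℕ
    #V = ∑[ v ∈ Vs ] is+ (deg v)
    #F = ∑[ e ∈ Es ] ⟦ F e ⟧
    w : Fin n → ℕ
    w v = 2 + 4 * is1 (deg v) + is2 (deg v)
    W : Subset n → ℕ
    W e = ∑[ v ∈ Vs ] (χ e v * w v)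
    rearrange₁ : ∀ a b → 3 * (2 * (a * b)) ≡ a * (6 * b)
    rearrange₁ = solve-∀
    rearrange₂ : ∀ a b c → a * (3 * b) + 9 * c ≡ 3 * (b * a + 3 * c)
    rearrange₂ = solve-∀
    demand : 6 * #V ℕ.≤ ∑[ e ∈ Es ] (⟦ F e ⟧ * W e)
    demand = begin
      6 * #V
        ≡⟨ ∑-*ˡ Vs 6 _ ⟨
      ∑[ v ∈ Vs ] (6 * is+ (deg v))
        ≤⟨ ∑-mono Vs (λ v → is+≤weight (deg v)) ⟩
      ∑[ v ∈ Vs ] (deg v * w v)
        ≡⟨ ∑-cong Vs (λ v → trans (sym (∑-*ʳ Es (w v) _)) (∑-cong Es (λ e → *-assoc ⟦ F e ⟧ (χ e v) (w v)))) ⟩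
      ∑[ v ∈ Vs ] ∑[ e ∈ Es ] (⟦ F e ⟧ * (χ e v * w v))
        ≡⟨ ∑-swap Vs Es _ ⟩
      ∑[ e ∈ Es ] ∑[ v ∈ Vs ] (⟦ F e ⟧ * (χ e v * w v))
        ≡⟨ ∑-cong Es (λ e → ∑-*ˡ Vs ⟦ F e ⟧ _) ⟩
      ∑[ e ∈ Es ] (⟦ F e ⟧ * W e) ∎
    W≡ : ∀ e → F e ≡ true → W e ≡ 2 * (5 + k) + 4 * s₁ e + s₂ e
    W≡ e Fe = begin-equality
      W e
        ≡⟨ ∑-cong Vs (λ v → distribute (χ e v) (is1 (deg v)) (is2 (deg v))) ⟩
      ∑[ v ∈ Vs ] (2 * χ e v + 4 * (χ e v * is1 (deg v)) + χ e v * is2 (deg v))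
        ≡⟨ trans (∑-+ Vs _ _) (cong (_+ s₂ e) (trans (∑-+ Vs _ _) (cong₂ _+_ (∑-*ˡ Vs 2 _) (∑-*ˡ Vs 4 _)))) ⟩
      2 * ∑ Vs (χ e) + 4 * s₁ e + s₂ e
        ≡⟨ cong (λ m → 2 * m + 4 * s₁ e + s₂ e) (trans (sym (card≡∑ e)) (uniform e Fe)) ⟩
      2 * (5 + k) + 4 * s₁ e + s₂ e ∎
      where
      distribute : ∀ a b c → a * (2 + 4 * b + c) ≡ 2 * a + 4 * (a * b) + a * c
      distribute = solve-∀
    edge : ∀ e → F e ≡ true → M k * W e ℕ.≤ 3 * N k + 9 * pairsIn e
    edge e Fe = ≤-trans (≤-reflexive (cong (M k *_) (W≡ e Fe)))
      (edge-inequality k (s₁ e) (s₂ e) (pairsIn e)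
        (≤-trans (s₁+s₂≤card e) (≤-reflexive (uniform e Fe)))
        (subst (λ c → c * s₁ e + c * s₁ e ℕ.≤ pairsIn e + (s₁ e + s₁ e * s₁ e)) (uniform e Fe)
          (pairsIn-deg-1 e Fe))
        (pairsIn-deg-2 e Fe (λ f Ff → trans (uniform f Ff) (sym (uniform e Fe)))))
    supply : ∀ e → M k * (⟦ F e ⟧ * W e) ℕ.≤ ⟦ F e ⟧ * (3 * N k) + 9 * (⟦ F e ⟧ * pairsIn e)
    supply e with F e in Fe
    ... | false = ≤-trans (≤-reflexive (*-zeroʳ (M k))) z≤n
    ... | true = begin
      M k * (1 * W e)                      ≡⟨ cong (M k *_) (*-identityˡ (W e)) ⟩
      M k * W e                            ≤⟨ edge e Fe ⟩
      3 * N k + 9 * pairsIn e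
        ≡⟨ cong₂ (λ a b → a + 9 * b) (*-identityˡ (3 * N k)) (*-identityˡ (pairsIn e)) ⟨
      1 * (3 * N k) + 9 * (1 * pairsIn e)  ∎

does⇒ : {P : Set} (p? : Dec P) → does p? ≡ true → P
does⇒ (yes p) _ = p

-- Two hypergraphs with the same projection

module SymmetricDifference {n : ℕ} (k : ℕ) (h g : Hypergraph n)
  (uniform-h : Uniform (5 + k) h) (uniform-g : Uniform (5 + k) g)
  (same : SameProj h g) (edges≤ : numEdges g ℕ.≤ numEdges h) where

  F : Hypergraph n
  F e = h e xor g e

  open Family F

  F-cases : ∀ e → F e ≡ true → h e ≡ true × g e ≡ false ⊎ h e ≡ false × g e ≡ true
  F-cases e Fe with h e | g e
  ... | true | false = inj₁ (refl , refl)
  ... | false | true = inj₂ (refl , refl)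

  uniform-F : Uniform (5 + k) F
  uniform-F e Fe with F-cases e Fe
  ... | inj₁ (he , _) = uniform-h e he
  ... | inj₂ (_ , ge) = uniform-g e ge

  F-left : ∀ e → h e ≡ true → g e ≡ false → F e ≡ true
  F-left e he ge rewrite he | ge = refl

  F-right : ∀ e → g e ≡ true → h e ≡ false → F e ≡ true
  F-right e ge he rewrite he | ge = refl

  -- The indicator of e ∩ V: the union V of the edges of F is the set of vertices of positive
  -- degree.
  ι : Subset n → Fin n → ℕ
  ι e v = χ e v * is+ (deg v)

  inside outside innerPairs : Subset n → ℕ
  inside e = ∑[ v ∈ Vs ] ι e v
  outside e = ∑[ v ∈ Vs ] (χ e v * (1 ∸ is+ (deg v)))
  innerPairs e = ∑[ u ∈ Vs ] ∑[ v ∈ Vs ] (⟦ not (does (u ≟ᶠ v)) ⟧ * (ι e u * ι e v))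

  inside+outside : ∀ e → inside e + outside e ≡ ∣ e ∣
  inside+outside e = trans (sym (∑-+ Vs _ _)) (trans (∑-cong Vs pointwise) (sym (card≡∑ e)))
    where
    pointwise : ∀ v → χ e v * is+ (deg v) + χ e v * (1 ∸ is+ (deg v)) ≡ χ e v
    pointwise v with deg v
    ... | zero = cong₂ _+_ (*-zeroʳ (χ e v)) (*-identityʳ (χ e v))
    ... | suc _ = trans (cong₂ _+_ (*-identityʳ (χ e v)) (*-zeroʳ (χ e v))) (+-identityʳ (χ e v))

  -- The diagonal terms of the square of `inside e` sum to `inside e`, because `ι` takes only the
  -- values 0 and 1.
  innerPairs+inside : ∀ e → innerPairs e + inside e ≡ inside e * inside e
  innerPairs+inside e = begin
    innerPairs e + inside e
      ≡⟨ cong (innerPairs e +_) (∑-cong Vs (λ u → onceᵛ (ι e) u)) ⟨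
    innerPairs e + ∑[ u ∈ Vs ] ∑[ v ∈ Vs ] (⟦ does (v ≟ᶠ u) ⟧ * ι e v)
      ≡⟨ ∑-+ Vs _ _ ⟨
    ∑[ u ∈ Vs ] (∑[ v ∈ Vs ] (⟦ not (does (u ≟ᶠ v)) ⟧ * (ι e u * ι e v)) + ∑[ v ∈ Vs ] (⟦ does (v ≟ᶠ u) ⟧ * ι e v))
      ≡⟨ ∑-cong Vs (λ u → trans (sym (∑-+ Vs _ _)) (trans (∑-cong Vs (pointwise u)) (∑-*ˡ Vs (ι e u) (ι e)))) ⟩
    ∑[ u ∈ Vs ] (ι e u * inside e)
      ≡⟨ ∑-*ʳ Vs (inside e) (ι e) ⟩
    inside e * inside e ∎
    where
    open ≡-Reasoning
    idem : ∀ b m → 1 * (⟦ b ⟧ * is+ m) ≡ ⟦ b ⟧ * is+ m * (⟦ b ⟧ * is+ m)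
    idem false _ = refl
    idem true zero = refl
    idem true (suc _) = refl
    pointwise : ∀ u v → ⟦ not (does (u ≟ᶠ v)) ⟧ * (ι e u * ι e v) + ⟦ does (v ≟ᶠ u) ⟧ * ι e v ≡ ι e u * ι e v
    pointwise u v with v ≟ᶠ u
    ... | yes refl rewrite dec-true (u ≟ᶠ u) refl = idem (lookup e u) (deg u)
    ... | no v≢u rewrite dec-false (u ≟ᶠ v) (v≢u ∘ sym) = trans (+-identityʳ _) (*-identityˡ _)

  deg-pos : ∀ {v e} → Through v e → 1 ℕ.≤ deg v
  deg-pos {v} {e} te = ≤-trans (≤-reflexive (sym (through-1 te)))
    (Enumeration.term≤∑ (subsetE n) (λ z → ⟦ F z ⟧ * χ z v) e)

  inside-F : ∀ e → F e ≡ true → inside e ≡ 5 + k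
  inside-F e Fe = trans (∑-cong Vs pointwise) (trans (sym (card≡∑ e)) (uniform-F e Fe))
    where
    pointwise : ∀ v → ι e v ≡ χ e v
    pointwise v with lookup e v in v∈e
    ... | false = refl
    ... | true = trans (*-identityˡ _) (is+≡1 (deg-pos (Fe , v∈e)))

  K H G C : Hypergraph n
  K e = h e ∧ does (2 ℕ.≤? inside e)
  H e = h e ∧ not (g e)
  G e = g e ∧ not (h e)
  C e = K e ∧ g e

  #_ : Hypergraph n → ℕ
  # A = ∑[ e ∈ Es ] ⟦ A e ⟧

  -- An edge of h outside g belongs to F, so all its 5 + k vertices lie in V and it passes the test
  -- in `K`. The other edges of `K` are those of `C`.
  #K : # K ≡ # H + # C
  #K = trans (∑-cong Es pointwise) (∑-+ Es _ _)
    where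
    pointwise : ∀ e → ⟦ K e ⟧ ≡ ⟦ H e ⟧ + ⟦ C e ⟧
    pointwise e with h e in he | g e in ge
    ... | false | _ = refl
    ... | true | true with does (2 ℕ.≤? inside e)
    ...   | true = refl
    ...   | false = refl
    pointwise e | true | false
      rewrite dec-true (2 ℕ.≤? inside e)
        (≤-trans (s≤s (s≤s z≤n)) (≤-reflexive (sym (inside-F e (F-left e he ge))))) = refl

  #F : # F ≡ # H + # G
  #F = trans (∑-cong Es pointwise) (∑-+ Es _ _)
    where
    pointwise : ∀ e → ⟦ F e ⟧ ≡ ⟦ H e ⟧ + ⟦ G e ⟧
    pointwise e with h e | g e
    ... | true | true = refl
    ... | true | false = refl
    ... | false | true = refl
    ... | false | false = refl

  -- The edges common to h and g contribute equally to both edge counts and cancel.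
  #G≤#H : # G ℕ.≤ # H
  #G≤#H = +-cancelʳ-≤ (∑[ e ∈ Es ] ⟦ h e ∧ g e ⟧) _ _
    (subst₂ ℕ._≤_ (trans (numEdges≡∑ g) (trans (∑-cong Es right) (∑-+ Es _ _)))
                  (trans (numEdges≡∑ h) (trans (∑-cong Es left) (∑-+ Es _ _))) edges≤)
    where
    left : ∀ e → ⟦ h e ⟧ ≡ ⟦ H e ⟧ + ⟦ h e ∧ g e ⟧
    left e with h e | g e
    ... | true | true = refl
    ... | true | false = refl
    ... | false | _ = refl
    right : ∀ e → ⟦ g e ⟧ ≡ ⟦ G e ⟧ + ⟦ h e ∧ g e ⟧
    right e with h e | g e
    ... | true | true = refl
    ... | true | false = refl
    ... | false | true = refl
    ... | false | false = refl

  -- Covering private pairs by common edges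

  codeg-1-cover : ∀ {u v e} (a b : Hypergraph n) → (∀ z → b z ≡ true → a z ≡ false → F z ≡ true) →
    codeg u v ≡ 1 → Through u e → Through v e → b e ≡ false → ProjEdge b u v →
    ∃ λ c → a c ≡ true × b c ≡ true × lookup c u ≡ true × lookup c v ≡ true
  codeg-1-cover {u} {v} {e} a b F-ba one ue ve be (_ , c , bc , u∈c , v∈c) with a c in ac
  ... | true = c , ac , bc , ∈⇒lookup u∈c , ∈⇒lookup v∈c
  ... | false = ⊥-elim (1+n≰n (≤-trans
    (≤-reflexive (sym (cong₂ _+_ (through₂-1 ue ve)
      (through₂-1 (F-ba c bc ac , ∈⇒lookup u∈c) (F-ba c bc ac , ∈⇒lookup v∈c)))))
    (≤-trans (terms₂≤∑ᵉ (λ z → ⟦ F z ⟧ * (χ z u * χ z v)) c≢e) (≤-reflexive one))))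
    where
    c≢e : c ≢ e
    c≢e refl with trans (sym bc) be
    ... | ()

  -- The edge of F over the pair belongs to only one of h and g; equality of the projections
  -- supplies an edge of the other, and `codeg-1-cover` shows that this edge is common to both.
  private-cover : ∀ {u v} → u ≢ v → codeg u v ≡ 1 →
    ∃ λ c → C c ≡ true × ι c u ≡ 1 × ι c v ≡ 1
  private-cover {u} {v} u≢v one
    with ∑-pos Es (λ z → ⟦ F z ⟧ * (χ z u * χ z v)) (≤-reflexive (sym one))
  ... | e , p with through₂-pos {u} {v} {e} p
  ... | ue , ve = conclude common
    where
    common : ∃ λ c → (h c ≡ true × g c ≡ true) × lookup c u ≡ true × lookup c v ≡ true
    common with F-cases e (proj₁ ue)
    ... | inj₁ (he , ge) with codeg-1-cover h g F-right one ue ve ge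
      (Equivalence.to (same u v) (u≢v , e , he , lookup⇒∈ e u (proj₂ ue) , lookup⇒∈ e v (proj₂ ve)))
    ...   | c , hc , gc , uv∈c = c , (hc , gc) , uv∈c
    common | inj₂ (he , ge) with codeg-1-cover g h F-left one ue ve he
      (Equivalence.from (same u v) (u≢v , e , ge , lookup⇒∈ e u (proj₂ ue) , lookup⇒∈ e v (proj₂ ve)))
    ...   | c , gc , hc , uv∈c = c , (hc , gc) , uv∈c
    conclude : (∃ λ c → (h c ≡ true × g c ≡ true) × lookup c u ≡ true × lookup c v ≡ true) →
      ∃ λ c → C c ≡ true × ι c u ≡ 1 × ι c v ≡ 1
    conclude (c , (hc , gc) , u∈c , v∈c) = c , Cc , ιu , ιv
      where
      ιu : ι c u ≡ 1
      ιu rewrite u∈c = trans (*-identityˡ _) (is+≡1 (deg-pos ue))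
      ιv : ι c v ≡ 1
      ιv rewrite v∈c = trans (*-identityˡ _) (is+≡1 (deg-pos ve))
      -- Both u and v lie on an edge of F, so they are two distinct vertices of c in V, as
      -- membership in `C` demands.
      two : 2 ℕ.≤ inside c
      two = ≤-trans (≤-reflexive (sym (cong₂ _+_ ιu ιv)))
        (Enumeration.terms₂≤∑ (finE n) (ι c) (u≢v ∘ sym))
      Cc : C c ≡ true
      Cc rewrite hc | gc | dec-true (2 ℕ.≤? inside c) two = refl

  pairs≤ : pairs ℕ.≤ ∑[ e ∈ Es ] (⟦ C e ⟧ * innerPairs e)
  pairs≤ = begin
    pairs
      ≤⟨ ∑-mono Vs (λ u → ∑-mono Vs (pointwise u)) ⟩
    ∑[ u ∈ Vs ] ∑[ v ∈ Vs ] ∑[ e ∈ Es ] (⟦ C e ⟧ * term e u v)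
      ≡⟨ ∑-cong Vs (λ u → ∑-swap Vs Es _) ⟩
    ∑[ u ∈ Vs ] ∑[ e ∈ Es ] ∑[ v ∈ Vs ] (⟦ C e ⟧ * term e u v)
      ≡⟨ ∑-swap Vs Es _ ⟩
    ∑[ e ∈ Es ] ∑[ u ∈ Vs ] ∑[ v ∈ Vs ] (⟦ C e ⟧ * term e u v)
      ≡⟨ ∑-cong Es (λ e → trans (∑-cong Vs (λ u → ∑-*ˡ Vs ⟦ C e ⟧ _)) (∑-*ˡ Vs ⟦ C e ⟧ _)) ⟩
    ∑[ e ∈ Es ] (⟦ C e ⟧ * innerPairs e) ∎
    where
    open ≤-Reasoning
    term : Subset n → Fin n → Fin n → ℕ
    term e u v = ⟦ not (does (u ≟ᶠ v)) ⟧ * (ι e u * ι e v)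
    private≤1 : ∀ u v → isPrivate u v ℕ.≤ 1
    private≤1 u v = *-mono-≤ (⟦⟧≤1 (not (does (u ≟ᶠ v)))) (≤-trans (m≤m+n _ _) (is1+is2≤1 (codeg u v)))
    pointwise : ∀ u v → isPrivate u v ℕ.≤ ∑[ e ∈ Es ] (⟦ C e ⟧ * term e u v)
    pointwise u v with 1 ℕ.≤? isPrivate u v
    ... | no ¬p = ≤-trans (≤-reflexive (n<1⇒n≡0 (≰⇒> ¬p))) z≤n
    ... | yes p with private-pos p
    ... | u≢v , one with private-cover u≢v one
    ... | c , Cc , ιu , ιv = begin
      isPrivate u v           ≤⟨ private≤1 u v ⟩
      1                      ≡⟨ value ⟨
      ⟦ C c ⟧ * term c u v   ≤⟨ Enumeration.term≤∑ (subsetE n) (λ e → ⟦ C e ⟧ * term e u v) c ⟩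
      ∑[ e ∈ Es ] (⟦ C e ⟧ * term e u v) ∎
      where
      value : ⟦ C c ⟧ * term c u v ≡ 1
      value rewrite Cc | dec-false (u ≟ᶠ v) u≢v | ιu | ιv = refl

  -- The dense subhypergraph

  degK : Fin n → ℕ
  degK v = ∑[ e ∈ Es ] (⟦ K e ⟧ * χ e v)

  -- The vertex set is the union of the edges of `K`, the smallest one allowed, which makes the
  -- density as large as possible.
  sub : SubHypergraph h
  sub = record
    { verts = Vec.tabulate (λ v → does (1 ℕ.≤? degK v))
    ; edges = K
    ; edges⊆ = λ e → ∧-conicalˡ _ _
    ; edgesInVerts = λ e Ke {v} v∈e → lookup⇒∈ _ v (trans (Vec.lookup∘tabulate _ v)
        (dec-true (1 ℕ.≤? degK v) (covered e v Ke (∈⇒lookup v∈e))))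
    }
    where
    covered : ∀ e v → K e ≡ true → lookup e v ≡ true → 1 ℕ.≤ degK v
    covered e v Ke v∈e = ≤-trans (≤-reflexive (sym value))
      (Enumeration.term≤∑ (subsetE n) (λ z → ⟦ K z ⟧ * χ z v) e)
      where
      value : ⟦ K e ⟧ * χ e v ≡ 1
      value rewrite Ke | v∈e = refl

  -- Edges of `H` lie inside V, so a vertex of `sub` outside V is on an edge of `C` and is counted
  -- by `outside` there.
  vK≤ : vK sub ℕ.≤ ∑[ v ∈ Vs ] is+ (deg v) + ∑[ e ∈ Es ] (⟦ C e ⟧ * outside e)
  vK≤ = begin
    vK sub
      ≡⟨ trans (card≡∑ (verts sub)) (∑-cong Vs (λ v → cong ⟦_⟧ (Vec.lookup∘tabulate _ v))) ⟩
    ∑[ v ∈ Vs ] ⟦ does (1 ℕ.≤? degK v) ⟧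
      ≤⟨ ∑-mono Vs pointwise ⟩
    ∑[ v ∈ Vs ] (is+ (deg v) + ∑[ e ∈ Es ] (⟦ C e ⟧ * (χ e v * (1 ∸ is+ (deg v)))))
      ≡⟨ ∑-+ Vs _ _ ⟩
    ∑[ v ∈ Vs ] is+ (deg v) + ∑[ v ∈ Vs ] ∑[ e ∈ Es ] (⟦ C e ⟧ * (χ e v * (1 ∸ is+ (deg v))))
      ≡⟨ cong (∑[ v ∈ Vs ] is+ (deg v) +_) (trans (∑-swap Vs Es _) (∑-cong Es (λ e → ∑-*ˡ Vs ⟦ C e ⟧ _))) ⟩
    ∑[ v ∈ Vs ] is+ (deg v) + ∑[ e ∈ Es ] (⟦ C e ⟧ * outside e) ∎
    where
    open ≤-Reasoning
    ⟦1≤?⟧≤ : ∀ m → ⟦ does (1 ℕ.≤? m) ⟧ ℕ.≤ m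
    ⟦1≤?⟧≤ zero = z≤n
    ⟦1≤?⟧≤ (suc m) = s≤s z≤n
    new-vertex : ∀ v → deg v ≡ 0 → ∀ e → ⟦ K e ⟧ * χ e v ℕ.≤ ⟦ C e ⟧ * (χ e v * 1)
    new-vertex v deg-v e with h e in he | g e in ge | lookup e v in v∈e
    ... | false | _ | _ = z≤n
    ... | true | _ | false = ≤-trans (≤-reflexive (*-zeroʳ ⟦ does (2 ℕ.≤? inside e) ⟧)) z≤n
    ... | true | false | true =
      ⊥-elim (1+n≰n (≤-trans (deg-pos (F-left e he ge , v∈e)) (≤-reflexive deg-v)))
    ... | true | true | true with does (2 ℕ.≤? inside e)
    ...   | true = ≤-refl
    ...   | false = z≤n
    pointwise : ∀ v → ⟦ does (1 ℕ.≤? degK v) ⟧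
      ℕ.≤ is+ (deg v) + ∑[ e ∈ Es ] (⟦ C e ⟧ * (χ e v * (1 ∸ is+ (deg v))))
    pointwise v = by-degree (deg v) refl
      where
      by-degree : ∀ m → deg v ≡ m → ⟦ does (1 ℕ.≤? degK v) ⟧
        ℕ.≤ is+ m + ∑[ e ∈ Es ] (⟦ C e ⟧ * (χ e v * (1 ∸ is+ m)))
      by-degree zero eq = ≤-trans (⟦1≤?⟧≤ (degK v)) (∑-mono Es (new-vertex v eq))
      by-degree (suc m) _ = ≤-trans (⟦⟧≤1 (does (1 ℕ.≤? degK v))) (m≤m+n 1 _)

  gain : ∀ e → ⟦ C e ⟧ * (2 * (M k * outside e)) + ⟦ C e ⟧ * (3 * innerPairs e) ℕ.≤ ⟦ C e ⟧ * (2 * N k)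
  gain e with C e in Ce
  ... | false = z≤n
  ... | true = begin
    1 * (2 * (M k * outside e)) + 1 * (3 * innerPairs e)
      ≡⟨ cong₂ _+_ (*-identityˡ (2 * (M k * outside e))) (*-identityˡ (3 * innerPairs e)) ⟩
    2 * (M k * outside e) + 3 * innerPairs e
      ≤⟨ gain-inequality k (inside e) (outside e) (innerPairs e) two
           (trans (inside+outside e) (uniform-h e (∧-conicalˡ _ _ Ke))) (innerPairs+inside e) ⟩
    2 * N k
      ≡⟨ *-identityˡ (2 * N k) ⟨
    1 * (2 * N k) ∎
    where
    open ≤-Reasoning
    Ke : K e ≡ true
    Ke = ∧-conicalˡ _ _ Ce
    two : 2 ℕ.≤ inside e
    two = does⇒ (2 ℕ.≤? inside e) (∧-conicalʳ (h e) _ Ke)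

  sub-dense : M k * vK sub ℕ.≤ N k * eK sub
  sub-dense = *-cancelˡ-≤ 2 (begin
    2 * (M k * vK sub)
      ≤⟨ *-monoʳ-≤ 2 (*-monoʳ-≤ (M k) vK≤) ⟩
    2 * (M k * (#V + ∑C outside))
      ≡⟨ rearrange₁ (M k) #V (∑C outside) ⟩
    2 * (M k * #V) + 2 * M k * ∑C outside
      ≤⟨ +-monoˡ-≤ (2 * M k * ∑C outside) (vertices-bound k uniform-F) ⟩
    N k * # F + 3 * pairs + 2 * M k * ∑C outside
      -- Each edge of `H` now carries 2 `N k`, and the private pairs are charged to the edges of `C`
      -- covering them. Each edge of `C` likewise has a budget of 2 `N k` for these pairs and its
      -- new vertices.
      ≤⟨ +-monoˡ-≤ (2 * M k * ∑C outside) (+-mono-≤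
           (*-monoʳ-≤ (N k) (≤-trans (≤-reflexive #F) (+-monoʳ-≤ (# H) #G≤#H))) (*-monoʳ-≤ 3 pairs≤)) ⟩
    N k * (# H + # H) + 3 * ∑C innerPairs + 2 * M k * ∑C outside
      ≡⟨ rearrange₂ (N k * (# H + # H)) (3 * ∑C innerPairs) (2 * M k * ∑C outside) ⟩
    N k * (# H + # H) + (2 * M k * ∑C outside + 3 * ∑C innerPairs)
      ≤⟨ +-monoʳ-≤ (N k * (# H + # H)) total-gain ⟩
    N k * (# H + # H) + # C * (2 * N k)
      ≡⟨ rearrange₃ (N k) (# H) (# C) ⟩
    2 * (N k * (# H + # C))
      ≡⟨ cong (λ m → 2 * (N k * m)) (trans (numEdges≡∑ K) #K) ⟨
    2 * (N k * eK sub) ∎)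
    where
    open ≤-Reasoning
    #V : ℕ
    #V = ∑[ v ∈ Vs ] is+ (deg v)
    ∑C : (Subset n → ℕ) → ℕ
    ∑C f = ∑[ e ∈ Es ] (⟦ C e ⟧ * f e)
    rearrange₁ : ∀ m a b → 2 * (m * (a + b)) ≡ 2 * (m * a) + 2 * m * b
    rearrange₁ = solve-∀
    rearrange₂ : ∀ a b c → a + b + c ≡ a + (c + b)
    rearrange₂ = solve-∀
    rearrange₃ : ∀ a b c → a * (b + b) + c * (2 * a) ≡ 2 * (a * (b + c))
    rearrange₃ = solve-∀
    factor₁ : ∀ m a b → a * (2 * (m * b)) ≡ 2 * m * (a * b)
    factor₁ = solve-∀
    factor₂ : ∀ a b → a * (3 * b) ≡ 3 * (a * b)
    factor₂ = solve-∀
    total-gain : 2 * M k * ∑C outside + 3 * ∑C innerPairs ℕ.≤ # C * (2 * N k)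
    total-gain = begin
      2 * M k * ∑C outside + 3 * ∑C innerPairs
        ≡⟨ cong₂ _+_
             (trans (∑-cong Es (λ e → factor₁ (M k) ⟦ C e ⟧ (outside e))) (∑-*ˡ Es (2 * M k) _))
             (trans (∑-cong Es (λ e → factor₂ ⟦ C e ⟧ (innerPairs e))) (∑-*ˡ Es 3 _)) ⟨
      ∑[ e ∈ Es ] (⟦ C e ⟧ * (2 * (M k * outside e))) + ∑[ e ∈ Es ] (⟦ C e ⟧ * (3 * innerPairs e))
        ≡⟨ ∑-+ Es _ _ ⟨
      ∑[ e ∈ Es ] (⟦ C e ⟧ * (2 * (M k * outside e)) + ⟦ C e ⟧ * (3 * innerPairs e))
        ≤⟨ ∑-mono Es gain ⟩
      ∑[ e ∈ Es ] (⟦ C e ⟧ * (2 * N k))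
        ≡⟨ ∑-*ʳ Es (2 * N k) _ ⟩
      # C * (2 * N k) ∎

  module _ (distinct : Distinct h g) where

    -- If `H` were empty then so would be `G`, being no larger, and h and g would coincide.
    #H-pos : 1 ℕ.≤ # H
    #H-pos with 1 ℕ.≤? # H
    ... | yes p = p
    ... | no ¬p = ⊥-elim (distinct equal)
      where
      none : ∀ A → ¬ (1 ℕ.≤ # A) → ∀ e → A e ≡ false
      none A ¬q e with A e in Ae
      ... | false = refl
      ... | true = ⊥-elim (¬q (≤-trans (≤-reflexive (cong ⟦_⟧ (sym Ae)))
        (Enumeration.term≤∑ (subsetE n) (λ z → ⟦ A z ⟧) e)))
      equal : ∀ e → h e ≡ g e
      equal e with h e | g e | none H ¬p e | none G (λ q → ¬p (≤-trans q #G≤#H)) e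
      ... | true | true | _ | _ = refl
      ... | false | false | _ | _ = refl

    eK-pos : 1 ℕ.≤ eK sub
    eK-pos = ≤-trans #H-pos (≤-trans (m≤m+n (# H) (# C)) (≤-reflexive (sym (trans (numEdges≡∑ K) #K))))

    vK-pos : 1 ℕ.≤ vK sub
    vK-pos with ∑-pos Es (λ e → ⟦ K e ⟧) (≤-trans eK-pos (≤-reflexive (numEdges≡∑ K)))
    ... | e , p = ≤-trans (s≤s z≤n) (≤-trans
      (≤-reflexive (sym (uniform-h e (edges⊆ sub e (⟦⟧-pos _ p)))))
      (p⊆q⇒∣p∣≤∣q∣ (edgesInVerts sub e (⟦⟧-pos _ p))))

-- From natural numbers to the rational bound

open import Data.Integer using (+_)
open import Data.Rational using (ℚ; mkℚ; NonZero; _/_; _-_; _≤_; 1/_)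

module _ (m N e v : ℕ) (1≤e : 1 ℕ.≤ e) (dense : suc m * suc v ℕ.≤ N * e) where

  private
    frac : ∀ i j → ℚ.toℚᵘ (i / suc j) ℚᵘ.≃ ℚᵘ.mkℚᵘ i j
    frac i j = ℚ.toℚᵘ-fromℚᵘ (ℚᵘ.mkℚᵘ i j)

    cross : ∀ p r .(c : Coprime ℤ.∣ p ∣ (suc r)) → (+ e) / suc v ≤ mkℚ p r c → + e ℤ.* + suc r ℤ.≤ p ℤ.* + suc v
    cross p r c le = ℚᵘ.drop-*≤* (ℚᵘ.≤-respˡ-≃ (frac (+ e) v) (ℚ.toℚᵘ-mono-≤ le))

    crossℕ : ∀ p r .(c : Coprime p (suc r)) → (+ e) / suc v ≤ mkℚ (+ p) r c → e * suc r ℕ.≤ p * suc v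
    crossℕ p r c le = ℤ.drop‿+≤+ (subst₂ ℤ._≤_ (sym (ℤ.pos-* e (suc r))) (sym (ℤ.pos-* p (suc v))) (cross (+ p) r c le))

  -- Write M for `suc m`. As c - a/M = N/M, the claim amounts to 1/q ≤ N/M, and q is at least a
  -- density that is at least M/N. Since e ≥ 1 that density is positive, which rules out q ≤ 0 and
  -- makes the reciprocal meaningful.
  reciprocal-bound : ∀ a c → a + N ≡ c * suc m → ∀ q → (+ e) / suc v ≤ q →
    Σ (NonZero q) λ nz → (+ a) / suc m ≤ (+ c) / 1 - (1/ q) {{nz}}
  reciprocal-bound a c a+N (mkℚ (ℤ.+ zero) r cop) le =
    ⊥-elim (1+n≰n (≤-trans (*-mono-≤ 1≤e (s≤s (z≤n {r}))) (crossℕ zero r cop le)))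
  reciprocal-bound a c a+N (mkℚ (ℤ.-[1+ p ]) r cop) le = ⊥-elim (contra (cross _ r cop le))
    where
    contra : ¬ (+ e ℤ.* + suc r ℤ.≤ ℤ.-[1+ p ] ℤ.* + suc v)
    contra ineq with subst (ℤ._≤ ℤ.-[1+ p ] ℤ.* + suc v) (sym (ℤ.pos-* e (suc r))) ineq
    ... | ()
  -- The inequality is proved as a/M + 1/q ≤ c, and 1/q is then subtracted from both sides.
  reciprocal-bound a c a+N q@(mkℚ (ℤ.+[1+ p ]) r cop) le = _ , subst (_≤ (+ c) / 1 - 1/ q) cancel
    (ℚ.+-monoˡ-≤ (ℚ.- (1/ q)) sum≤)
    where
    cancel : (+ a) / suc m ℚ.+ 1/ q ℚ.- 1/ q ≡ (+ a) / suc m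
    cancel = trans (ℚ.+-assoc ((+ a) / suc m) (1/ q) (ℚ.- (1/ q)))
      (trans (cong ((+ a) / suc m ℚ.+_) (ℚ.+-inverseʳ (1/ q))) (ℚ.+-identityʳ _))
    -- This is 1/q ≤ N/M with denominators cleared. Multiplying by `suc v` lets `dense` and the
    -- lower bound on q be chained, with e as the middle quantity.
    reciprocal : suc r * suc m ℕ.≤ N * suc p
    reciprocal = *-cancelʳ-≤ _ _ (suc v) (begin
      suc r * suc m * suc v   ≡⟨ *-assoc (suc r) (suc m) (suc v) ⟩
      suc r * (suc m * suc v) ≤⟨ *-monoʳ-≤ (suc r) dense ⟩
      suc r * (N * e)         ≡⟨ rotate (suc r) N e ⟩
      N * (e * suc r)         ≤⟨ *-monoʳ-≤ N (crossℕ (suc p) r cop le) ⟩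
      N * (suc p * suc v)     ≡⟨ *-assoc N (suc p) (suc v) ⟨
      N * suc p * suc v       ∎)
      where
      open ≤-Reasoning
      rotate : ∀ x y z → x * (y * z) ≡ y * (z * x)
      rotate = solve-∀
    numerators : (a * suc p + suc r * suc m) * 1 ℕ.≤ c * (suc m * suc p)
    numerators = begin
      (a * suc p + suc r * suc m) * 1 ≡⟨ *-identityʳ _ ⟩
      a * suc p + suc r * suc m       ≤⟨ +-monoʳ-≤ (a * suc p) reciprocal ⟩
      a * suc p + N * suc p           ≡⟨ *-distribʳ-+ (suc p) a N ⟨
      (a + N) * suc p                 ≡⟨ cong (_* suc p) a+N ⟩
      c * suc m * suc p               ≡⟨ *-assoc c (suc m) (suc p) ⟩
      c * (suc m * suc p)             ∎
      where open ≤-Reasoning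
    sum≤ : (+ a) / suc m ℚ.+ 1/ q ≤ (+ c) / 1
    sum≤ = ℚ.toℚᵘ-cancel-≤ (ℚᵘ.≤-respʳ-≃ (ℚᵘ.≃-sym (frac (+ c) 0)) (ℚᵘ.≤-respˡ-≃
      (ℚᵘ.≃-sym (ℚᵘ.≃-trans (ℚ.toℚᵘ-homo-+ ((+ a) / suc m) (1/ q))
        (ℚᵘ.+-congˡ (ℚ.toℚᵘ (1/ q)) (frac (+ a) m))))
      (ℚᵘ.*≤* (subst₂ ℤ._≤_ lhs (ℤ.pos-* c (suc m * suc p)) (ℤ.+≤+ numerators)))))
      where
      lhs : + ((a * suc p + suc r * suc m) * 1) ≡ (+ a ℤ.* + suc p ℤ.+ + suc r ℤ.* + suc m) ℤ.* + 1
      lhs = trans (ℤ.pos-* (a * suc p + suc r * suc m) 1) (cong (ℤ._* + 1) (trans (ℤ.pos-+ (a * suc p) (suc r * suc m))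
        (cong₂ ℤ._+_ (ℤ.pos-* a (suc p)) (ℤ.pos-* (suc r) (suc m)))))

theorem36 : (d n : ℕ) → 5 ℕ.≤ d → (h g : Hypergraph n) →
    Uniform d h → Uniform d g → Distinct h g → SameProj h g →
    numEdges g ℕ.≤ numEdges h →
    (q : ℚ) → IsMaxDensity h q →
    Σ (NonZero q) λ nz →
    (+ (2 * d ∸ 4)) / suc (2 * d ∸ 2) ≤ ((+ (d ∸ 1)) / 1) - (1/ q) {{nz}}
theorem36 d@(suc (suc (suc (suc (suc k))))) n (s≤s (s≤s (s≤s (s≤s (s≤s z≤n))))) h g
  uniform-h uniform-g distinct same edges≤ q (_ , maximal) =
  conclude (vK sub) (ℕ.>-nonZero (vK-pos distinct)) sub-dense (maximal sub (ℕ.>-nonZero (vK-pos distinct)))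
  where
  open SymmetricDifference k h g uniform-h uniform-g same edges≤
  denominator : ∀ k → 4 + k + (5 + (k + 0)) ≡ 9 + 2 * k
  denominator = solve-∀
  -- The identity (2d - 4) + N = (d - 1)(2d - 1), which is where the value of N comes from.
  threshold : ∀ k → 1 + k + (5 + (k + 0)) + (30 + 15 * k + 2 * (k * k)) ≡ (4 + k) * (4 + k + (5 + (k + 0)))
  threshold = solve-∀
  -- The vertex count is abstracted to a variable so that it can be matched as a successor.
  conclude : ∀ v (nz : ℕ.NonZero v) → M k * v ℕ.≤ N k * eK sub → ((+ eK sub) / v) {{nz}} ≤ q →
    Σ (NonZero q) λ nz → (+ (2 * d ∸ 4)) / suc (2 * d ∸ 2) ≤ ((+ (d ∸ 1)) / 1) - (1/ q) {{nz}}
  conclude (suc v) _ dense = reciprocal-bound (2 * d ∸ 2) (N k) (eK sub) v (eK-pos distinct)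
    (≤-trans (≤-reflexive (cong (_* suc v) (denominator k))) dense)
    (2 * d ∸ 4) (d ∸ 1) (threshold k) q
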